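{- A lattice simplex $\Delta$ is spanning if and only if the corresponding linear code $C_\Delta$ can be generated by a matrix $g$ whose rows have height one.
   Context: Let $M\cong\mathbb{Z}^d$ be a lattice and $\Delta$ a $d$-dimensional lattice simplex in $M\otimes\mathbb{R}$ with vertices $v_0,\dots,v_d\in M$. $\Delta$ is spanning if every point of $M\oplus\mathbb{Z}$ is an integer linear combination of the lattice points of $\Delta\times\{1\}$. Code of a simplex: $\mathbb{Z}_N=\mathbb{Z}/N\mathbb{Z}$, with elements identified with the representatives $0,\dots,N-1$. Let $\Lambda_\Delta=\{x\in(\mathbb{R}/\mathbb{Z})^{d+1}:\sum_i\{x_i\}(v_i,1)\in M\oplus\mathbb{Z}\}$, where $\{\cdot\}$ is the fractional part. $N_\Delta$ is the least common multiple of the denominators of all coordinates of elements of $\Lambda_\Delta$, and $C_\Delta=\{(N_\Delta\{x_0\},\dots,N_\Delta\{x_d\}):x\in\Lambda_\Delta\}\subseteq\mathbb{Z}_{N_\Delta}^{d+1}$, a submodule all of whose words have coordinate sum $0\bmod N_\Delta$. The height of a word $c\in C_\Delta$ is the integer $\frac1{N_\Delta}\sum_{i=0}^d c_i$ (sum of the representatives). $C_\Delta$ is generated by $g$ if it is the submodule generated by the rows of $g$; the zero code is regarded as generated by the empty matrix (no rows). -}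

module Defs where

open import Algebra.Bundles using (CommutativeRing)
import Algebra.Properties.Semiring.Sum as Sum
open import Data.Fin.Base using (Fin; zero; suc; toℕ; fromℕ<; punchIn; punchOut; finToFun; funToFin)
open import Data.Fin.Properties
  using (any?; all?; toℕ-fromℕ<; punchIn-punchOut; finToFun-funToFin)
  renaming (_≟_ to _≟F_)
open import Data.Integer.Base as ℤ using (ℤ; +_; -[1+_])
import Data.Integer.DivMod as ℤ
import Data.Integer.Properties as ℤ
import Data.Integer.Tactic.RingSolver as ℤ-Solver
open import Data.Nat.Base as ℕ using (ℕ; zero; suc; NonZero)
import Data.Nat.Properties as ℕ
open import Data.Nat.Coprimality as Coprimality using (coprime-divisor)
open import Data.Nat.Divisibility
  using (_∣_; _∣?_; divides; ∣-trans; 1∣_; 0∣⇒≡0)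
open import Data.Nat.DivMod using (_mod_; m<n⇒m/n≡0)
open import Data.Nat.LCM using (lcm; m∣lcm[m,n]; n∣lcm[m,n]; lcm-least)
open import Data.Product.Base using (∃; _×_; _,_; proj₁; proj₂)
open import Data.Rational.Base as ℚ
  using (ℚ; mkℚ; 0ℚ; 1ℚ; _/_; floor; ↥_; ↧_; ↧ₙ_; toℚᵘ)
import Data.Rational.Properties as ℚ
open import Data.Rational.Solver using (module +-*-Solver)
open import Data.Rational.Unnormalised.Base as ℚᵘ using (mkℚᵘ; *≡*)
import Data.Rational.Unnormalised.Properties as ℚᵘ
open import Data.Sum.Base using (inj₁; inj₂)
open import Data.Vec.Functional using (Vector; insertAt; removeAt)
open import Data.Vec.Functional.Properties using (insertAt-lookup; insertAt-punchIn)
open import Function.Base using (_∘_)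
open import Function.Bundles using (_⇔_)
open import Level using (0ℓ)
open import Relation.Binary.PropositionalEquality
open import Relation.Nullary using (¬_; Dec; yes; no; contradiction; ¬?)
open import Relation.Nullary.Decidable using (map′; decidable-stable; _×-dec_)
open import Relation.Unary using (Pred)

module ∑ℕ = Sum ℕ.+-*-semiring
module ∑ℤ = Sum (CommutativeRing.semiring ℤ.+-*-commutativeRing)
module ∑ℚ = Sum (CommutativeRing.semiring ℚ.+-*-commutativeRing)

open ∑ℕ using () renaming (sum to sumℕ) public
open ∑ℤ using () renaming (sum to sumℤ) public
open ∑ℚ using () renaming (sum to sumℚ) public

ι : ℤ → ℚ
ι z = z / 1

-- The library's fracPart rounds towards 0 and takes an absolute value, so on
-- negative arguments it is not the representative in [0,1) modulo ℤ.
frac : ℚ → ℚ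
frac p = p ℚ.- ι (floor p)

------------------------------------------------------------------------
-- Lattice simplices

-- The lattice M is ℤᵈ.  Real scalars are replaced by rational ones: the vᵢ are
-- integral and affinely independent, so real barycentric coordinates of a
-- lattice point, and real representatives of the elements of Λ, are rational.

record LatticeSimplex (d : ℕ) : Set where
  field
    vertex              : Vector (Vector ℤ d) (suc d)
    affinelyIndependent :
      ∀ (c : Vector ℚ (suc d)) →
      sumℚ c ≡ 0ℚ →
      (∀ k → sumℚ (λ i → c i ℚ.* ι (vertex i k)) ≡ 0ℚ) →
      ∀ i → c i ≡ 0ℚ

open LatticeSimplex public

module _ {d : ℕ} (Δ : LatticeSimplex d) where

  record LatticePoint (p : Vector ℤ d) : Set where
    field
      coordinate  : Vector ℚ (suc d)
      nonNegative : ∀ i → 0ℚ ℚ.≤ coordinate i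
      total       : sumℚ coordinate ≡ 1ℚ
      combination : ∀ k → sumℚ (λ i → coordinate i ℚ.* ι (vertex Δ i k)) ≡ ι (p k)

  -- The point (q , h) of M ⊕ ℤ is the combination Σⱼ aⱼ (pⱼ , 1).
  Spanning : Set
  Spanning = ∀ (q : Vector ℤ d) (h : ℤ) →
    ∃ λ n → ∃ λ (p : Vector (Vector ℤ d) n) → ∃ λ (a : Vector ℤ n) →
      (∀ j → LatticePoint (p j)) ×
      (∀ k → sumℤ (λ j → a j ℤ.* p j k) ≡ q k) ×
      sumℤ (λ j → a j ℤ.* ℤ.1ℤ) ≡ h

  -- x represents an element of (ℚ/ℤ)ᵈ⁺¹.  Everything below depends only on its
  -- class: the reduced denominators of the xᵢ and the fractional parts are
  -- unchanged by integer translations.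
  record Λ (x : Vector ℚ (suc d)) : Set where
    constructor mkΛ
    field
      point         : Vector ℤ d
      level         : ℤ
      integralPoint : ∀ k → sumℚ (λ i → frac (x i) ℚ.* ι (vertex Δ i k)) ≡ ι (point k)
      integralLevel : sumℚ (λ i → frac (x i) ℚ.* 1ℚ) ≡ ι level

  Denominator : Pred ℕ 0ℓ
  Denominator m = ∃ λ x → Λ x × ∃ λ i → ↧ₙ (x i) ≡ m

-- Extends the library's LCM from two numbers to a possibly infinite set.
record IsLCM (S : Pred ℕ 0ℓ) (n : ℕ) : Set where
  field
    commonMultiple : ∀ {m} → S m → m ∣ n
    least          : ∀ {m} → (∀ {k} → S k → k ∣ m) → n ∣ m

------------------------------------------------------------------------
-- Existence of a least common multiple of the denominators

private
  record Int (q : ℚ) : Set where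
    constructor _,_
    field
      value : ℤ
      eq    : q ≡ ι value

  ι-toℚᵘ : ∀ z → toℚᵘ (ι z) ℚᵘ.≃ mkℚᵘ z 0
  ι-toℚᵘ z = ℚ.toℚᵘ-fromℚᵘ (mkℚᵘ z 0)

  ι-+ : ∀ a b → ι a ℚ.+ ι b ≡ ι (a ℤ.+ b)
  ι-+ a b = ℚ.toℚᵘ-injective (begin
    toℚᵘ (ι a ℚ.+ ι b)            ≈⟨ ℚ.toℚᵘ-homo-+ (ι a) (ι b) ⟩
    toℚᵘ (ι a) ℚᵘ.+ toℚᵘ (ι b)    ≈⟨ ℚᵘ.+-cong (ι-toℚᵘ a) (ι-toℚᵘ b) ⟩
    mkℚᵘ a 0 ℚᵘ.+ mkℚᵘ b 0        ≈⟨ *≡* (lemma a b) ⟩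
    mkℚᵘ (a ℤ.+ b) 0              ≈⟨ ι-toℚᵘ (a ℤ.+ b) ⟨
    toℚᵘ (ι (a ℤ.+ b))            ∎)
    where
    open ℚᵘ.≃-Reasoning
    lemma : ∀ a b → (a ℤ.* + 1 ℤ.+ b ℤ.* + 1) ℤ.* + 1 ≡ (a ℤ.+ b) ℤ.* + 1
    lemma = ℤ-Solver.solve-∀

  ι-* : ∀ a b → ι a ℚ.* ι b ≡ ι (a ℤ.* b)
  ι-* a b = ℚ.toℚᵘ-injective (begin
    toℚᵘ (ι a ℚ.* ι b)            ≈⟨ ℚ.toℚᵘ-homo-* (ι a) (ι b) ⟩
    toℚᵘ (ι a) ℚᵘ.* toℚᵘ (ι b)    ≈⟨ ℚᵘ.*-cong (ι-toℚᵘ a) (ι-toℚᵘ b) ⟩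
    mkℚᵘ a 0 ℚᵘ.* mkℚᵘ b 0        ≈⟨ ι-toℚᵘ (a ℤ.* b) ⟨
    toℚᵘ (ι (a ℤ.* b))            ∎)
    where open ℚᵘ.≃-Reasoning

  Int-+ : ∀ {p q} → Int p → Int q → Int (p ℚ.+ q)
  Int-+ (a , refl) (b , refl) = a ℤ.+ b , ι-+ a b

  Int-* : ∀ {p q} → Int p → Int q → Int (p ℚ.* q)
  Int-* (a , refl) (b , refl) = a ℤ.* b , ι-* a b

  Int-neg : ∀ {p} → Int p → Int (ℚ.- p)
  Int-neg {p} P = subst Int lemma (Int-* {ι -[1+ 0 ]} (-[1+ 0 ] , refl) P)
    where
    open +-*-Solver
    lemma : ι -[1+ 0 ] ℚ.* p ≡ ℚ.- p
    lemma = solve 1 (λ p → con (ι -[1+ 0 ]) :* p := :- p) refl p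

  Int-sub : ∀ {p q} → Int p → Int q → Int (p ℚ.- q)
  Int-sub P Q = Int-+ P (Int-neg Q)

  Int-sum : ∀ {n} {f : Vector ℚ n} → (∀ i → Int (f i)) → Int (sumℚ f)
  Int-sum {zero}  F = + 0 , refl
  Int-sum {suc n} F = Int-+ (F zero) (Int-sum (F ∘ suc))

  -- A rational becomes integral on multiplication by t exactly when its
  -- denominator divides t.

  Int-scaled : ∀ t q {z} → ι (+ t) ℚ.* q ≡ ι z → + t ℤ.* ↥ q ≡ z ℤ.* ↧ q
  Int-scaled t q@record{} {z} eq = cancel (begin
    mkℚᵘ (+ t) 0 ℚᵘ.* toℚᵘ q      ≈⟨ ℚᵘ.*-cong (ι-toℚᵘ (+ t)) ℚᵘ.≃-refl ⟨
    toℚᵘ (ι (+ t)) ℚᵘ.* toℚᵘ q    ≈⟨ ℚ.toℚᵘ-homo-* (ι (+ t)) q ⟨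
    toℚᵘ (ι (+ t) ℚ.* q)          ≈⟨ ℚ.toℚᵘ-cong eq ⟩
    toℚᵘ (ι z)                    ≈⟨ ι-toℚᵘ z ⟩
    mkℚᵘ z 0                      ∎)
    where
    open ℚᵘ.≃-Reasoning
    cancel : mkℚᵘ (+ t) 0 ℚᵘ.* toℚᵘ q ℚᵘ.≃ mkℚᵘ z 0 → + t ℤ.* ↥ q ≡ z ℤ.* ↧ q
    cancel (*≡* e) = trans (sym (ℤ.*-identityʳ _))
      (trans e (cong (z ℤ.*_) (cong +_ (ℕ.+-identityʳ _))))

  Int⇒∣ : ∀ t q → Int (ι (+ t) ℚ.* q) → ↧ₙ q ∣ t
  Int⇒∣ t q@(mkℚ n e c) (z , eq) =
    coprime-divisor (Coprimality.sym (Coprimality.recompute c))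
      (divides ℤ.∣ z ∣ (begin
        ℤ.∣ n ∣ ℕ.* t           ≡⟨ ℕ.*-comm ℤ.∣ n ∣ t ⟩
        t ℕ.* ℤ.∣ n ∣           ≡⟨ ℤ.abs-* (+ t) n ⟨
        ℤ.∣ + t ℤ.* n ∣         ≡⟨ cong ℤ.∣_∣ (Int-scaled t q {z} eq) ⟩
        ℤ.∣ z ℤ.* + suc e ∣     ≡⟨ ℤ.abs-* z (+ suc e) ⟩
        ℤ.∣ z ∣ ℕ.* suc e       ∎))
    where open ≡-Reasoning

  ∣⇒Int : ∀ t q → ↧ₙ q ∣ t → Int (ι (+ t) ℚ.* q)
  ∣⇒Int t q@record{} (divides k refl) = + k ℤ.* ↥ q , ℚ.toℚᵘ-injective (begin
    toℚᵘ (ι (+ t) ℚ.* q)          ≈⟨ ℚ.toℚᵘ-homo-* (ι (+ t)) q ⟩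
    toℚᵘ (ι (+ t)) ℚᵘ.* toℚᵘ q    ≈⟨ ℚᵘ.*-cong (ι-toℚᵘ (+ t)) ℚᵘ.≃-refl ⟩
    mkℚᵘ (+ t) 0 ℚᵘ.* toℚᵘ q      ≈⟨ *≡* lemma ⟩
    mkℚᵘ (+ k ℤ.* ↥ q) 0          ≈⟨ ι-toℚᵘ (+ k ℤ.* ↥ q) ⟨
    toℚᵘ (ι (+ k ℤ.* ↥ q))        ∎)
    where
    open ℚᵘ.≃-Reasoning
    ring : ∀ k n e → (k ℤ.* e ℤ.* n) ℤ.* + 1 ≡ k ℤ.* n ℤ.* e
    ring = ℤ-Solver.solve-∀
    lemma : (+ t ℤ.* ↥ q) ℤ.* + 1 ≡ (+ k ℤ.* ↥ q) ℤ.* + (1 ℕ.* ↧ₙ q)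
    lemma = trans (cong (λ s → (s ℤ.* ↥ q) ℤ.* + 1) (ℤ.pos-* k (↧ₙ q)))
      (trans (ring (+ k) (↥ q) (↧ q))
        (cong (λ s → (+ k ℤ.* ↥ q) ℤ.* + s) (sym (ℕ.*-identityˡ (↧ₙ q)))))

  Int? : ∀ q → Dec (Int q)
  Int? q = map′
    (λ p → subst Int (ℚ.*-identityˡ q) (∣⇒Int 1 q p))
    (λ i → Int⇒∣ 1 q (subst Int (sym (ℚ.*-identityˡ q)) i))
    (↧ₙ q ∣? 1)

  -- Fractional parts are the rationals in [0,1).

  Small : ℚ → Set
  Small q = ∃ λ m → ↥ q ≡ + m × m ℕ.< ↧ₙ q

  frac-small : ∀ p → Small (frac p)
  frac-small p@(mkℚ n e _) = go (frac p) eq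
    where
    open ℚᵘ.≃-Reasoning
    fl = floor p
    r  = n ℤ.% + suc e
    ring : ∀ a b c → ((a ℤ.+ b ℤ.* c) ℤ.* + 1 ℤ.+ (ℤ.- b) ℤ.* c) ℤ.* c
                   ≡ a ℤ.* (c ℤ.* + 1)
    ring = ℤ-Solver.solve-∀
    lemma : (n ℤ.* + 1 ℤ.+ (ℤ.- fl) ℤ.* + suc e) ℤ.* + suc e ≡ + r ℤ.* + (suc e ℕ.* 1)
    lemma = trans
      (cong (λ s → (s ℤ.* + 1 ℤ.+ (ℤ.- fl) ℤ.* + suc e) ℤ.* + suc e) (ℤ.a≡a%n+[a/n]*n n (+ suc e)))
      (trans (ring (+ r) fl (+ suc e)) (cong (+ r ℤ.*_) (sym (ℤ.pos-* (suc e) 1))))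
    eq : toℚᵘ (frac p) ℚᵘ.≃ mkℚᵘ (+ r) e
    eq = begin
      toℚᵘ (p ℚ.- ι fl)               ≈⟨ ℚ.toℚᵘ-homo-+ p (ℚ.- ι fl) ⟩
      toℚᵘ p ℚᵘ.+ toℚᵘ (ℚ.- ι fl)     ≈⟨ ℚᵘ.+-congʳ (toℚᵘ p) (ℚ.toℚᵘ-homo‿- (ι fl)) ⟩
      toℚᵘ p ℚᵘ.- toℚᵘ (ι fl)         ≈⟨ ℚᵘ.+-congʳ (toℚᵘ p) (ℚᵘ.-‿cong (ι-toℚᵘ fl)) ⟩
      toℚᵘ p ℚᵘ.- mkℚᵘ fl 0           ≈⟨ *≡* lemma ⟩
      mkℚᵘ (+ r) e                    ∎
    go : ∀ f → toℚᵘ f ℚᵘ.≃ mkℚᵘ (+ r) e → Small f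
    go (mkℚ (+ m) f _) (*≡* h) = m , refl , ℕ.*-cancelʳ-< (suc e) m (suc f) (subst₂ ℕ._<_
        (sym (ℤ.+-injective (trans (ℤ.pos-* m (suc e)) (trans h (sym (ℤ.pos-* r (suc f)))))))
        (ℕ.*-comm (suc e) (suc f))
        (ℕ.*-monoˡ-< (suc f) (ℤ.n%d<d n (+ suc e))))
    go (mkℚ -[1+ m ] f _) (*≡* h) with trans h (sym (ℤ.pos-* r (suc f)))
    ... | ()

  frac-idem : ∀ {q} → Small q → frac q ≡ q
  frac-idem {q@(mkℚ _ e _)} (m , refl , m<e) =
    trans (cong (λ z → q ℚ.- ι z) floor≡0) (ℚ.+-identityʳ q)
    where
    floor≡0 : floor q ≡ + 0
    floor≡0 = trans (ℤ.div-pos-is-/ℕ (+ m) (suc e)) (cong +_ (m<n⇒m/n≡0 m<e))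

  -- Elimination: over independent integral rows, integrality of a combination
  -- bounds the denominators of its coefficients.

  lin : ∀ {n} a b (c u w : Vector ℚ n) →
        sumℚ (λ j → c j ℚ.* (a ℚ.* u j ℚ.- w j ℚ.* b)) ≡
        a ℚ.* sumℚ (λ j → c j ℚ.* u j) ℚ.- b ℚ.* sumℚ (λ j → c j ℚ.* w j)
  lin {zero}  a b c u w = solve 2 (λ a b → con 0ℚ := a :* con 0ℚ :- b :* con 0ℚ) refl a b
    where open +-*-Solver
  lin {suc n} a b c u w = trans
    (cong (c zero ℚ.* (a ℚ.* u zero ℚ.- w zero ℚ.* b) ℚ.+_) (lin a b (c ∘ suc) (u ∘ suc) (w ∘ suc)))
    (solve 7 (λ a b c u w s t →
        c :* (a :* u :- w :* b) :+ (a :* s :- b :* t) :=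
        a :* (c :* u :+ s) :- b :* (c :* w :+ t)) refl
      a b (c zero) (u zero) (w zero) _ _)
    where open +-*-Solver

  cancel : ∀ {a b} → ¬ a ≡ 0ℚ → b ℚ.* a ≡ 0ℚ → b ≡ 0ℚ
  cancel {a} {b} a≢0 eq = begin
    b                    ≡⟨ ℚ.*-identityʳ b ⟨
    b ℚ.* 1ℚ             ≡⟨ cong (b ℚ.*_) (ℚ.*-inverseʳ a) ⟨
    b ℚ.* (a ℚ.* 1/a)    ≡⟨ ℚ.*-assoc b a 1/a ⟨
    b ℚ.* a ℚ.* 1/a      ≡⟨ cong (ℚ._* 1/a) eq ⟩
    0ℚ ℚ.* 1/a           ≡⟨ ℚ.*-zeroˡ 1/a ⟩
    0ℚ                   ∎
    where
    open ≡-Reasoning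
    instance _ = ℚ.≢-nonZero a≢0
    1/a = ℚ.1/ a

  Independent : ∀ {m n} → (Fin m → Fin n → ℚ) → Set
  Independent {m} A = ∀ (c : Vector ℚ m) →
    (∀ k → sumℚ (λ i → c i ℚ.* A i k) ≡ 0ℚ) → ∀ i → c i ≡ 0ℚ

  clear : ∀ n {m} (A : Fin m → Fin n → ℚ) → (∀ i k → Int (A i k)) → Independent A →
    ∃ λ D → ¬ D ≡ + 0 ×
      (∀ (x : Vector ℚ m) → (∀ k → Int (sumℚ (λ i → x i ℚ.* A i k))) → ∀ i → Int (ι D ℚ.* x i))
  clear zero {zero}  A _ ind = + 1 , (λ ()) , λ _ _ ()
  clear zero {suc m} A _ ind with () ← ind (λ _ → 1ℚ) (λ ()) zero
  clear (suc n) {m} A intA ind with any? (λ i → ¬? (A i zero ℚ.≟ 0ℚ))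
  ... | no none =
    let D , D≢0 , h = clear n (λ i k → A i (suc k)) (λ i k → intA i (suc k))
                        (λ c e → ind c (λ { zero → col0 c ; (suc k) → e k }))
    in D , D≢0 , λ x e → h x (e ∘ suc)
    where
    A0 : ∀ i → A i zero ≡ 0ℚ
    A0 i = decidable-stable (A i zero ℚ.≟ 0ℚ) (λ ne → none (i , ne))
    col0 : ∀ c → sumℚ (λ i → c i ℚ.* A i zero) ≡ 0ℚ
    col0 c = trans (∑ℚ.sum-cong-≗ (λ i → trans (cong (c i ℚ.*_) (A0 i)) (ℚ.*-zeroʳ (c i))))
                   (∑ℚ.sum-replicate-zero m)
  clear (suc n) {suc m} A intA ind | yes (p , a≢0) =
    let D , D≢0 , h = clear n A' intA' ind'
    in D ℤ.* z , (λ e → nz D≢0 e) , λ x e → final D x e (h (removeAt x p) (reduced x e))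
    where
    a = A p zero
    z = Int.value (intA p zero)
    a≡z = Int.eq (intA p zero)
    u : Fin n → Vector ℚ m
    u k j = A (punchIn p j) (suc k)
    w : Vector ℚ m
    w j = A (punchIn p j) zero
    A' : Fin m → Fin n → ℚ
    A' j k = a ℚ.* u k j ℚ.- w j ℚ.* A p (suc k)
    intA' : ∀ j k → Int (A' j k)
    intA' j k = Int-sub (Int-* (intA p zero) (intA _ _)) (Int-* (intA _ _) (intA _ _))
    z≢0 : ¬ z ≡ + 0
    z≢0 e = a≢0 (trans a≡z (cong ι e))
    nz : ∀ {D} → ¬ D ≡ + 0 → ¬ D ℤ.* z ≡ + 0
    nz {D} D≢0 e with ℤ.i*j≡0⇒i≡0∨j≡0 D e
    ... | inj₁ q = D≢0 q
    ... | inj₂ q = z≢0 q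
    split : ∀ (x : Vector ℚ (suc m)) k → sumℚ (λ i → x i ℚ.* A i k) ≡
      x p ℚ.* A p k ℚ.+ sumℚ (λ j → x (punchIn p j) ℚ.* A (punchIn p j) k)
    split x k = ∑ℚ.sum-remove {i = p} (λ i → x i ℚ.* A i k)

    ind' : Independent A'
    ind' c e j = cancel a≢0 (trans (sym (insertAt-punchIn ca p v j)) (ind c̃ zeros (punchIn p j)))
      where
      ca = λ j → c j ℚ.* a
      v  = ℚ.- sumℚ (λ j → c j ℚ.* w j)
      c̃  = insertAt ca p v
      scale : ∀ {l} (b f : Vector ℚ l) → sumℚ (λ j → b j ℚ.* a ℚ.* f j) ≡ a ℚ.* sumℚ (λ j → b j ℚ.* f j)
      scale b f = trans
        (∑ℚ.sum-cong-≗ (λ j → solve 3 (λ b a f → b :* a :* f := a :* (b :* f)) refl (b j) a (f j)))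
        (sym (∑ℚ.*-distribˡ-sum a (λ j → b j ℚ.* f j)))
        where open +-*-Solver
      expand : ∀ k → sumℚ (λ i → c̃ i ℚ.* A i k) ≡
               v ℚ.* A p k ℚ.+ a ℚ.* sumℚ (λ j → c j ℚ.* A (punchIn p j) k)
      expand k = trans (split c̃ k) (cong₂ ℚ._+_
        (cong (ℚ._* A p k) (insertAt-lookup ca p v))
        (trans (∑ℚ.sum-cong-≗ (λ j → cong (ℚ._* A (punchIn p j) k) (insertAt-punchIn ca p v j)))
               (scale c _)))
      zeros : ∀ k → sumℚ (λ i → c̃ i ℚ.* A i k) ≡ 0ℚ
      zeros zero = trans (expand zero)
        (solve 2 (λ s a → :- s :* a :+ a :* s := con 0ℚ) refl (sumℚ (λ j → c j ℚ.* w j)) a)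
        where open +-*-Solver
      zeros (suc k) = trans (expand (suc k)) (trans
        (solve 4 (λ s b a t → :- s :* b :+ a :* t := a :* t :- b :* s) refl
          (sumℚ (λ j → c j ℚ.* w j)) (A p (suc k)) a (sumℚ (λ j → c j ℚ.* u k j)))
        (trans (sym (lin a (A p (suc k)) c (u k) w)) (e k)))
        where open +-*-Solver

    reduced : ∀ x → (∀ k → Int (sumℚ (λ i → x i ℚ.* A i k))) →
              ∀ k → Int (sumℚ (λ j → removeAt x p j ℚ.* A' j k))
    reduced x e k = subst Int (sym eq)
      (Int-sub (Int-* (intA p zero) (e (suc k))) (Int-* (intA p (suc k)) (e zero)))
      where
      open +-*-Solver
      x' = removeAt x p
      b  = A p (suc k)
      eq : sumℚ (λ j → x' j ℚ.* A' j k) ≡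
           a ℚ.* sumℚ (λ i → x i ℚ.* A i (suc k)) ℚ.- b ℚ.* sumℚ (λ i → x i ℚ.* A i zero)
      eq = trans (lin a b x' (u k) w) (trans
        (solve 5 (λ a b y s t →
          a :* s :- b :* t := a :* (y :* b :+ s) :- b :* (y :* a :+ t)) refl
          a b (x p) (sumℚ (λ j → x' j ℚ.* u k j)) (sumℚ (λ j → x' j ℚ.* w j)))
        (sym (cong₂ (λ s t → a ℚ.* s ℚ.- b ℚ.* t) (split x (suc k)) (split x zero))))

    final : ∀ D x → (∀ k → Int (sumℚ (λ i → x i ℚ.* A i k))) →
            (∀ j → Int (ι D ℚ.* removeAt x p j)) → ∀ i → Int (ι (D ℤ.* z) ℚ.* x i)
    final D x e f i = subst (λ y → Int (y ℚ.* x i)) (trans (cong (ι D ℚ.*_) a≡z) (ι-* D z)) go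
      where
      open +-*-Solver
      go : Int (ι D ℚ.* a ℚ.* x i)
      go with p ≟F i
      ... | yes refl = subst Int
        (trans
          (cong₂ (λ s t → ι D ℚ.* s ℚ.- t) (split x zero)
            (trans (∑ℚ.sum-cong-≗ (λ j → ℚ.*-assoc (ι D) (removeAt x p j) (w j)))
                   (sym (∑ℚ.*-distribˡ-sum (ι D) (λ j → removeAt x p j ℚ.* w j)))))
          (solve 4 (λ d y a s → d :* (y :* a :+ s) :- d :* s := d :* a :* y) refl
            (ι D) (x p) a (sumℚ (λ j → removeAt x p j ℚ.* w j))))
        (Int-sub (Int-* (D , refl) (e zero)) (Int-sum (λ j → Int-* (f j) (intA (punchIn p j) zero))))
      ... | no p≢i = subst Int
        (trans (cong (λ i → a ℚ.* (ι D ℚ.* x i)) (punchIn-punchOut p≢i))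
          (solve 3 (λ a d y → a :* (d :* y) := d :* a :* y) refl a (ι D) (x i)))
        (Int-* (intA p zero) (f (punchOut p≢i)))

  lcmAll : ∀ n → Vector ℕ n → ℕ
  lcmAll zero    f = 1
  lcmAll (suc n) f = lcm (f zero) (lcmAll n (f ∘ suc))

  ∣lcmAll : ∀ n f i → f i ∣ lcmAll n f
  ∣lcmAll (suc n) f zero    = m∣lcm[m,n] (f zero) _
  ∣lcmAll (suc n) f (suc i) = ∣-trans (∣lcmAll n (f ∘ suc) i) (n∣lcm[m,n] (f zero) _)

  lcmAll-least : ∀ n f {t} → (∀ i → f i ∣ t) → lcmAll n f ∣ t
  lcmAll-least zero    f h = 1∣ _
  lcmAll-least (suc n) f h = lcm-least (h zero) (lcmAll-least n (f ∘ suc) (h ∘ suc))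

  module _ {d : ℕ} (Δ : LatticeSimplex d) where

    hat : Fin (suc d) → Fin (suc d) → ℚ
    hat i zero    = 1ℚ
    hat i (suc k) = ι (vertex Δ i k)

    hat-int : ∀ i k → Int (hat i k)
    hat-int i zero    = + 1 , refl
    hat-int i (suc k) = vertex Δ i k , refl

    hat-independent : Independent hat
    hat-independent c e = affinelyIndependent Δ c
      (trans (∑ℚ.sum-cong-≗ (λ i → sym (ℚ.*-identityʳ (c i)))) (e zero)) (e ∘ suc)

    Λ-int : ∀ {x} → Λ Δ x → ∀ k → Int (sumℚ (λ i → frac (x i) ℚ.* hat i k))
    Λ-int (mkΛ q t e f) zero    = t , f
    Λ-int (mkΛ q t e f) (suc k) = q k , e k

    Int-abs : ∀ D {y} → Int (ι D ℚ.* y) → Int (ι (+ ℤ.∣ D ∣) ℚ.* y)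
    Int-abs (+ n)          I = I
    Int-abs (-[1+ n ]) {y} I = subst Int
      (trans (sym (ℚ.*-assoc (ι -[1+ 0 ]) (ι -[1+ n ]) y))
        (cong (ℚ._* y) (trans (ι-* -[1+ 0 ] -[1+ n ]) (cong (λ m → ι (+ suc m)) (ℕ.+-identityʳ n)))))
      (Int-* {ι -[1+ 0 ]} {ι -[1+ n ] ℚ.* y} (-[1+ 0 ] , refl) I)

    bound : ∃ λ D → NonZero D × (∀ {x} → Λ Δ x → ∀ i → Int (ι (+ D) ℚ.* frac (x i)))
    bound =
      let D , D≢0 , h = clear (suc d) hat hat-int hat-independent
      in ℤ.∣ D ∣ , ℤ.≢-nonZero D≢0 ,
         λ {x} x∈Λ i → Int-abs D (h (λ i → frac (x i)) (Λ-int x∈Λ) i)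

    Int-frac : ∀ t p → Int (ι (+ t) ℚ.* frac p) → Int (ι (+ t) ℚ.* p)
    Int-frac t p I = subst Int
      (solve 3 (λ t p f → t :* (p :- f) :+ t :* f := t :* p) refl (ι (+ t)) p (ι (floor p)))
      (Int-+ I (Int-* (+ t , refl) (floor p , refl)))
      where open +-*-Solver

    Λ? : ∀ x → Dec (Λ Δ x)
    Λ? x = map′
      (λ (f , g) → mkΛ (Int.value ∘ f) (Int.value g) (Int.eq ∘ f) (Int.eq g))
      (λ (mkΛ q h f g) → (λ k → q k , f k) , (h , g))
      (all? (λ k → Int? _) ×-dec Int? _)

    Λ-cong : ∀ {x y} → (∀ i → frac (x i) ≡ frac (y i)) → Λ Δ x → Λ Δ y
    Λ-cong eq (mkΛ q h f g) = mkΛ q h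
      (λ k → trans (∑ℚ.sum-cong-≗ (λ i → cong (ℚ._* ι (vertex Δ i k)) (sym (eq i)))) (f k))
      (trans (∑ℚ.sum-cong-≗ (λ i → cong (ℚ._* 1ℚ) (sym (eq i)))) g)

    module _ (D : ℕ) .{{_ : NonZero D}}
             (h : ∀ {x} → Λ Δ x → ∀ i → Int (ι (+ D) ℚ.* frac (x i))) where

      candidate : Fin (D ℕ.^ suc d) → Vector ℚ (suc d)
      candidate e i = + toℕ (finToFun {D} {suc d} e i) / D

      contribution : ∀ {x} → Dec (Λ Δ x) → ℕ
      contribution {x} (yes _) = lcmAll (suc d) (λ i → ↧ₙ (x i))
      contribution     (no _)  = 1

      N′ : ℕ
      N′ = lcmAll (D ℕ.^ suc d) (λ e → contribution (Λ? (candidate e)))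

      code : ∀ {q} → Small q → ↧ₙ q ∣ D → ∃ λ (k : Fin D) → + toℕ k / D ≡ q
      code {q@(mkℚ _ e _)} (m , refl , m<e) (divides k D≡ke) =
        fromℕ< m*k<D , ℚ.toℚᵘ-injective (begin
          toℚᵘ (+ toℕ (fromℕ< m*k<D) / D) ≡⟨ cong (λ s → toℚᵘ (+ s / D)) (toℕ-fromℕ< m*k<D) ⟩
          toℚᵘ (+ (m ℕ.* k) / D)          ≈⟨ over D (m ℕ.* k) ⟩
          mkℚᵘ (+ (m ℕ.* k)) (ℕ.pred D)   ≈⟨ *≡* lemma ⟩
          mkℚᵘ (+ m) e                    ∎)
        where
        open ℚᵘ.≃-Reasoning
        k≢0 : NonZero k
        k≢0 = ℕ.≢-nonZero (λ { refl → ℕ.≢-nonZero⁻¹ D D≡ke })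
        m*k<D : m ℕ.* k ℕ.< D
        m*k<D = subst (m ℕ.* k ℕ.<_) (trans (ℕ.*-comm (suc e) k) (sym D≡ke))
          (ℕ.*-monoˡ-< k {{k≢0}} m<e)
        over : ∀ D .{{_ : NonZero D}} n → toℚᵘ (+ n / D) ℚᵘ.≃ mkℚᵘ (+ n) (ℕ.pred D)
        over (suc D) n = ℚ.toℚᵘ-fromℚᵘ (mkℚᵘ (+ n) D)
        lemma : + (m ℕ.* k) ℤ.* + suc e ≡ + m ℤ.* + suc (ℕ.pred D)
        lemma = trans (sym (ℤ.pos-* (m ℕ.* k) (suc e)))
          (trans (cong +_ (trans (ℕ.*-assoc m k (suc e))
                            (cong (m ℕ.*_) (trans (sym D≡ke) (sym (ℕ.suc-pred D))))))
            (ℤ.pos-* m (suc (ℕ.pred D))))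

      cover : ∀ {x} → Λ Δ x → ∃ λ e → ∀ i → candidate e i ≡ frac (x i)
      cover {x} x∈Λ = funToFin f , λ i →
        trans (cong (λ k → + toℕ k / D) (finToFun-funToFin f i)) (proj₂ (c i))
        where
        c : ∀ i → ∃ λ (k : Fin D) → + toℕ k / D ≡ frac (x i)
        c i = code (frac-small (x i)) (Int⇒∣ D (frac (x i)) (h {x} x∈Λ i))
        f = proj₁ ∘ c

      contribution-∣ : ∀ {x} (dec : Dec (Λ Δ x)) → Λ Δ x → ∀ i → ↧ₙ (x i) ∣ contribution dec
      contribution-∣ {x} (yes _) _   i = ∣lcmAll (suc d) (λ i → ↧ₙ (x i)) i
      contribution-∣     (no ∉)  x∈Λ i = contradiction x∈Λ ∉

      contribution-least : ∀ {x t} (dec : Dec (Λ Δ x)) →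
        (∀ {k} → Denominator Δ k → k ∣ t) → contribution dec ∣ t
      contribution-least {x} (yes x∈Λ) S =
        lcmAll-least (suc d) (λ i → ↧ₙ (x i)) (λ i → S (x , x∈Λ , i , refl))
      contribution-least     (no _)    S = 1∣ _

      same : ∀ {x : Vector ℚ (suc d)} {e} → (∀ i → candidate e i ≡ frac (x i)) →
             ∀ i → frac (x i) ≡ frac (candidate e i)
      same {x} eq i = sym (trans (cong frac (eq i)) (frac-idem {frac (x i)} (frac-small (x i))))

      common : ∀ {m} → Denominator Δ m → m ∣ N′
      common (x , x∈Λ , i , refl) =
        let e , eq = cover {x} x∈Λ in
        Int⇒∣ N′ (x i) (Int-frac N′ (x i)
        (subst (λ q → Int (ι (+ N′) ℚ.* q)) (eq i)
          (∣⇒Int N′ (candidate e i) (∣-trans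
            (contribution-∣ {candidate e} (Λ? (candidate e)) (Λ-cong {x} {candidate e} (same {x} {e} eq) x∈Λ) i)
            (∣lcmAll (D ℕ.^ suc d) (λ e → contribution (Λ? (candidate e))) e)))))

      least : ∀ {m} → (∀ {k} → Denominator Δ k → k ∣ m) → N′ ∣ m
      least {m} S = lcmAll-least (D ℕ.^ suc d) (λ e → contribution (Λ? (candidate e)))
        (λ e → contribution-least {candidate e} {m} (Λ? (candidate e)) S)

      N′≢0 : NonZero N′
      N′≢0 = ℕ.≢-nonZero (λ N′≡0 → ℕ.≢-nonZero⁻¹ D (0∣⇒≡0 (subst (_∣ D) N′≡0
        (least (λ { (x , x∈Λ , i , refl) → Int⇒∣ D (x i) (Int-frac D (x i) (h {x} x∈Λ i)) })))))

    denominators-lcm : ∃ λ n → NonZero n × IsLCM (Denominator Δ) n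
    denominators-lcm =
      let D , D≢0 , h = bound
          instance _ = D≢0
      in N′ D h , N′≢0 D h , record { commonMultiple = common D h ; least = least D h }

------------------------------------------------------------------------
-- The code of a simplex

abstract
  N : ∀ {d} → LatticeSimplex d → ℕ
  N Δ = proj₁ (denominators-lcm Δ)

  -- This determines N, since a least common multiple is unique.
  N-isLCM : ∀ {d} (Δ : LatticeSimplex d) → IsLCM (Denominator Δ) (N Δ)
  N-isLCM Δ = proj₂ (proj₂ (denominators-lcm Δ))

  instance
    N-nonZero : ∀ {d} {Δ : LatticeSimplex d} → NonZero (N Δ)
    N-nonZero {Δ = Δ} = proj₁ (proj₂ (denominators-lcm Δ))

-- Fin m stands for ℤ/mℤ with its representatives 0,…,m-1.
Word : ℕ → ℕ → Set
Word m n = Vector (Fin m) n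

Code : ∀ {d} (Δ : LatticeSimplex d) → Pred (Word (N Δ) (suc d)) 0ℓ
Code Δ c = ∃ λ x → Λ Δ x × (∀ i → ι (+ N Δ) ℚ.* frac (x i) ≡ ι (+ toℕ (c i)))

-- Rational-valued, so that no rounding occurs on words whose coordinate sum is
-- not divisible by m.
height : ∀ {m n} .{{_ : NonZero m}} → Word m n → ℚ
height {m} c = + sumℕ (toℕ ∘ c) / m

linearCombination : ∀ {m n k} .{{_ : NonZero m}} →
                    Vector (Fin m) k → Vector (Word m n) k → Word m n
linearCombination {m} a g i = sumℕ (λ j → toℕ (a j) ℕ.* toℕ (g j i)) mod m

_GeneratedBy_ : ∀ {m n k} .{{_ : NonZero m}} →
                Pred (Word m n) 0ℓ → Vector (Word m n) k → Set
C GeneratedBy g = ∀ c → C c ⇔ (∃ λ a → ∀ i → c i ≡ linearCombination a g i)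

{-# OPTIONS --safe #-}
module Submission where

-- Write v̂ᵢ = (vᵢ , 1).  An integer vector y reduces modulo N to a codeword exactly
-- when N divides y₀v̂₀ + … + y_d v̂_d, and every point of M ⊕ ℤ is (1/N) Σ yᵢ v̂ᵢ for
-- a unique such y, since the denominators of its barycentric coordinates divide N.
-- The nonzero codewords of lattice points of Δ × {1} are the words of height one;
-- the vertices give the zero word.  An expression of a point as an integer
-- combination of lattice points is therefore, modulo N, an expression of its codeword
-- by words of height one, and the ambiguity N ℤᵈ⁺¹ is the span of the vertices.

open import Defs
open import Data.Fin.Base
  using (Fin; zero; suc; toℕ; fromℕ<; punchIn; punchOut; finToFun; funToFin; splitAt; _↑ˡ_; _↑ʳ_)
open import Data.Fin.Properties
  using (any?; all?; ¬∀⟶∃¬; toℕ<n; toℕ-fromℕ<; toℕ-injective; punchIn-punchOut; finToFun-funToFin)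
  renaming (_≟_ to _≟F_)
open import Data.Integer.Base as ℤ using (ℤ; +_; -[1+_]; 0ℤ; 1ℤ; _+_; _*_; _-_; -_)
import Data.Integer.DivMod as ℤ
import Data.Integer.Divisibility.Signed as ℤ
import Data.Integer.Properties as ℤ
import Data.Integer.Tactic.RingSolver as ℤ-Solver
open import Data.List.Base using (List; length; lookup; filter; allFin)
open import Data.List.Membership.Propositional.Properties using (∈-lookup; ∈-filter⁺; ∈-allFin)
import Data.List.Relation.Unary.All as All
open import Data.List.Relation.Unary.All.Properties using (all-filter)
open import Data.List.Relation.Unary.Any using (index)
open import Data.List.Relation.Unary.Any.Properties using (lookup-index)
open import Data.Nat.Base as ℕ using (ℕ; zero; suc; NonZero)
import Data.Nat.Coprimality as Coprimality
open import Data.Nat.Divisibility using (_∣_; divides)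
open import Data.Nat.DivMod using (_mod_; m<n⇒m/n≡0; m≡m%n+[m/n]*n; m%n<n; m<n⇒m%n≡m; [m+kn]%n≡m%n)
import Data.Nat.Properties as ℕ
open import Data.Product.Base using (∃; _×_; _,_; proj₁; proj₂)
open import Data.Rational.Base as ℚ using (ℚ; mkℚ; 0ℚ; 1ℚ; _/_; floor; ↥_; ↧_; ↧ₙ_; toℚᵘ)
import Data.Rational.Properties as ℚ
open import Data.Rational.Solver using (module +-*-Solver)
open import Data.Rational.Unnormalised.Base as ℚᵘ using (mkℚᵘ; *≡*)
import Data.Rational.Unnormalised.Properties as ℚᵘ
open import Data.Sum.Base using (_⊎_; inj₁; inj₂; [_,_]′)
open import Data.Vec.Functional using (Vector; _∷_; _++_; insertAt; removeAt)
open import Data.Vec.Functional.Properties using (insertAt-lookup; insertAt-punchIn; lookup-++ˡ; lookup-++ʳ)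
open import Function.Base using (_∘_)
open import Function.Bundles using (_⇔_; mk⇔; Equivalence)
open import Level using (0ℓ)
open import Relation.Binary.PropositionalEquality
open import Relation.Nullary using (¬_; Dec; yes; no; contradiction; ¬?)
open import Relation.Nullary.Decidable using (decidable-stable; map′; _×-dec_)
open import Relation.Unary using (Pred; Decidable)

-- Integer linear algebra

infix 8 _∙_

_∙_ : ∀ {n} → Vector ℤ n → Vector ℤ n → ℤ
u ∙ v = sumℤ (λ i → u i * v i)

∙-congˡ : ∀ {n} {u w : Vector ℤ n} → (∀ i → u i ≡ w i) → ∀ v → u ∙ v ≡ w ∙ v
∙-congˡ eq v = ∑ℤ.sum-cong-≗ (λ i → cong (_* v i) (eq i))

∙-congʳ : ∀ {n} (u : Vector ℤ n) {v w} → (∀ i → v i ≡ w i) → u ∙ v ≡ u ∙ w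
∙-congʳ u eq = ∑ℤ.sum-cong-≗ (λ i → cong (u i *_) (eq i))

∙-zeroˡ : ∀ {n} (v : Vector ℤ n) → (λ _ → 0ℤ) ∙ v ≡ 0ℤ
∙-zeroˡ {n} v = trans (∑ℤ.sum-cong-≗ (λ i → ℤ.*-zeroˡ (v i))) (∑ℤ.sum-replicate-zero n)

∙-zeroʳ : ∀ {n} (u : Vector ℤ n) → u ∙ (λ _ → 0ℤ) ≡ 0ℤ
∙-zeroʳ {n} u = trans (∑ℤ.sum-cong-≗ (λ i → ℤ.*-zeroʳ (u i))) (∑ℤ.sum-replicate-zero n)

∙-identityʳ : ∀ {n} (u : Vector ℤ n) → u ∙ (λ _ → 1ℤ) ≡ sumℤ u
∙-identityʳ u = ∑ℤ.sum-cong-≗ (λ i → ℤ.*-identityʳ (u i))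

∙-+ˡ : ∀ {n} (u w v : Vector ℤ n) → (λ i → u i + w i) ∙ v ≡ u ∙ v + w ∙ v
∙-+ˡ u w v = trans (∑ℤ.sum-cong-≗ (λ i → ℤ.*-distribʳ-+ (v i) (u i) (w i)))
  (∑ℤ.∑-distrib-+ (λ i → u i * v i) (λ i → w i * v i))

∙-*ˡ : ∀ {n} s (u v : Vector ℤ n) → (λ i → s * u i) ∙ v ≡ s * u ∙ v
∙-*ˡ s u v = trans (∑ℤ.sum-cong-≗ (λ i → ℤ.*-assoc s (u i) (v i)))
  (sym (∑ℤ.*-distribˡ-sum s (λ i → u i * v i)))

∙-minusˡ : ∀ {n} (u w v : Vector ℤ n) → (λ i → u i - w i) ∙ v ≡ u ∙ v - w ∙ v
∙-minusˡ u w v = trans (∙-+ˡ u (λ i → - w i) v) (cong (_+_ (u ∙ v))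
  (trans (∙-congˡ (λ i → sym (ℤ.-1*i≡-i (w i))) v)
    (trans (∙-*ˡ (- 1ℤ) w v) (ℤ.-1*i≡-i (w ∙ v)))))

∙-comm : ∀ {n} (u v : Vector ℤ n) → u ∙ v ≡ v ∙ u
∙-comm u v = ∑ℤ.sum-cong-≗ (λ i → ℤ.*-comm (u i) (v i))

∙-*ʳ : ∀ {n} s (u v : Vector ℤ n) → u ∙ (λ i → s * v i) ≡ s * u ∙ v
∙-*ʳ s u v = trans (∙-comm u _) (trans (∙-*ˡ s v u) (cong (s *_) (∙-comm v u)))

∙-+ʳ : ∀ {n} (u v w : Vector ℤ n) → u ∙ (λ i → v i + w i) ≡ u ∙ v + u ∙ w
∙-+ʳ u v w = trans (∑ℤ.sum-cong-≗ (λ i → ℤ.*-distribˡ-+ (u i) (v i) (w i)))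
  (∑ℤ.∑-distrib-+ (λ i → u i * v i) (λ i → u i * w i))

∙-assoc : ∀ {m n} (a : Vector ℤ m) (Y : Vector (Vector ℤ n) m) (v : Vector ℤ n) →
          (λ i → a ∙ (λ j → Y j i)) ∙ v ≡ a ∙ (λ j → Y j ∙ v)
∙-assoc a Y v = begin
  (λ i → a ∙ (λ j → Y j i)) ∙ v
    ≡⟨ ∑ℤ.sum-cong-≗ (λ i → ∑ℤ.*-distribʳ-sum (v i) (λ j → a j * Y j i)) ⟩
  sumℤ (λ i → sumℤ (λ j → a j * Y j i * v i))
    ≡⟨ ∑ℤ.∑-comm (λ i j → a j * Y j i * v i) ⟩
  sumℤ (λ j → sumℤ (λ i → a j * Y j i * v i))
    ≡⟨ ∑ℤ.sum-cong-≗ (λ j → ∙-*ˡ (a j) (Y j) v) ⟩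
  a ∙ (λ j → Y j ∙ v) ∎
  where open ≡-Reasoning

column : ∀ {m n} → Vector (Vector ℤ n) m → Fin n → Vector ℤ m
column A k i = A i k

Independent : ∀ {m n} → Vector (Vector ℤ n) m → Set
Independent A = ∀ c → (∀ k → c ∙ column A k ≡ 0ℤ) → ∀ i → c i ≡ 0ℤ

dependent : ∀ m (A : Vector (Vector ℤ m) (suc m)) →
  ∃ λ c → (∃ λ i → ¬ c i ≡ 0ℤ) × (∀ k → c ∙ column A k ≡ 0ℤ)
dependent zero    A = (λ _ → 1ℤ) , (zero , λ ()) , λ ()
dependent (suc m) A with any? (λ i → ¬? (A i zero ℤ.≟ 0ℤ))
... | no none =
  let c , (i , ci≢0) , c∙A≡0 = dependent m (λ i k → A (suc i) (suc k))
  in 0ℤ ∷ c , (suc i , ci≢0) , λ where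
    zero    → trans (∙-congʳ (0ℤ ∷ c) column0) (∙-zeroʳ (0ℤ ∷ c))
    (suc k) → trans (ℤ.+-identityˡ _) (c∙A≡0 k)
  where
  column0 : ∀ i → A i zero ≡ 0ℤ
  column0 i = decidable-stable (A i zero ℤ.≟ 0ℤ) (λ ne → none (i , ne))
... | yes (p , a≢0) =
  let c , (j , cj≢0) , c∙A′≡0 = dependent m A′
  in extend c , (punchIn p j , nonzero c j cj≢0) , vanishes c c∙A′≡0
  where
  a = A p zero
  w : Vector ℤ (suc m)
  w j = A (punchIn p j) zero
  A′ : Vector (Vector ℤ m) (suc m)
  A′ j k = a * A (punchIn p j) (suc k) + - A p (suc k) * w j
  extend : Vector ℤ (suc m) → Vector ℤ (suc (suc m))
  extend c = insertAt (λ j → a * c j) p (- (c ∙ w))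
  nonzero : ∀ c j → ¬ c j ≡ 0ℤ → ¬ extend c (punchIn p j) ≡ 0ℤ
  nonzero c j cj≢0 eq = [ a≢0 , cj≢0 ]′
    (ℤ.i*j≡0⇒i≡0∨j≡0 a (trans (sym (insertAt-punchIn (λ j → a * c j) p (- (c ∙ w)) j)) eq))
  expand : ∀ c k → extend c ∙ column A k ≡
           - (c ∙ w) * A p k + a * c ∙ (λ j → A (punchIn p j) k)
  expand c k = trans (∑ℤ.sum-remove {i = p} (λ i → extend c i * A i k)) (cong₂ _+_
    (cong (_* A p k) (insertAt-lookup (λ j → a * c j) p (- (c ∙ w))))
    (trans (∙-congˡ (insertAt-punchIn (λ j → a * c j) p (- (c ∙ w))) (λ j → A (punchIn p j) k))
           (∙-*ˡ a c (λ j → A (punchIn p j) k))))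
  vanishes : ∀ c → (∀ k → c ∙ column A′ k ≡ 0ℤ) → ∀ k → extend c ∙ column A k ≡ 0ℤ
  vanishes c c∙A′≡0 zero = trans (expand c zero) (ring (c ∙ w) a)
    where
    ring : ∀ s a → - s * a + a * s ≡ 0ℤ
    ring = ℤ-Solver.solve-∀
  vanishes c c∙A′≡0 (suc k) = begin
    extend c ∙ column A (suc k)        ≡⟨ expand c (suc k) ⟩
    - (c ∙ w) * b + a * c ∙ u            ≡⟨ ring (c ∙ w) b (a * c ∙ u) ⟩
    a * c ∙ u + - b * c ∙ w            ≡⟨ cong₂ _+_ (∙-*ʳ a c u) (∙-*ʳ (- b) c w) ⟨
    c ∙ (λ j → a * u j) + c ∙ (λ j → - b * w j)
      ≡⟨ ∙-+ʳ c (λ j → a * u j) (λ j → - b * w j) ⟨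
    c ∙ column A′ k                    ≡⟨ c∙A′≡0 k ⟩
    0ℤ                                 ∎
    where
    open ≡-Reasoning
    b = A p (suc k)
    u : Vector ℤ (suc m)
    u j = A (punchIn p j) (suc k)
    ring : ∀ s b t → - s * b + t ≡ t + - b * s
    ring = ℤ-Solver.solve-∀

solvable-up-to-multiple : ∀ {m} (A : Vector (Vector ℤ m) m) → Independent A → ∀ b →
  ∃ λ D → NonZero D × ∃ λ z → ∀ k → z ∙ column A k ≡ + D * b k
solvable-up-to-multiple {m} A independent b with dependent m (b ∷ A)
... | c , (i , ci≢0) , c∙A≡0 = solve (c zero) refl
  where
  c∙A≡-c₀b : ∀ k → (c ∘ suc) ∙ column A k ≡ - c zero * b k
  c∙A≡-c₀b k = trans (ring (c zero) (b k) _)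
    (trans (cong (_+ - c zero * b k) (c∙A≡0 k)) (ℤ.+-identityˡ _))
    where
    ring : ∀ c b s → s ≡ (c * b + s) + - c * b
    ring = ℤ-Solver.solve-∀
  c≡0 : c zero ≡ 0ℤ → ∀ i → c i ≡ 0ℤ
  c≡0 c₀≡0 zero    = c₀≡0
  c≡0 c₀≡0 (suc i) = independent (c ∘ suc)
    (λ k → trans (c∙A≡-c₀b k) (cong (λ s → - s * b k) c₀≡0)) i
  solve : ∀ s → c zero ≡ s → ∃ λ D → NonZero D × ∃ λ z → ∀ k → z ∙ column A k ≡ + D * b k
  solve (+ zero)  c₀≡s = contradiction (c≡0 c₀≡s i) ci≢0
  solve (+ suc n) c₀≡s = suc n , _ , (λ i → - 1ℤ * c (suc i)) , λ k →
    trans (∙-*ˡ (- 1ℤ) (c ∘ suc) (column A k))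
      (trans (cong (- 1ℤ *_) (trans (c∙A≡-c₀b k) (cong (λ s → - s * b k) c₀≡s)))
        (ring (+ suc n) (b k)))
    where
    ring : ∀ s b → - 1ℤ * (- s * b) ≡ s * b
    ring = ℤ-Solver.solve-∀
  solve -[1+ n ] c₀≡s = suc n , _ , c ∘ suc , λ k →
    trans (c∙A≡-c₀b k) (cong (λ s → - s * b k) c₀≡s)

-- Clearing denominators

ι≡mkℚ : ∀ z → ι z ≡ mkℚ z 0 (Coprimality.sym (Coprimality.1-coprimeTo _))
ι≡mkℚ z = ℚ.↥p/↧p≡p (mkℚ z 0 (Coprimality.sym (Coprimality.1-coprimeTo _)))

ι-injective : ∀ a b → ι a ≡ ι b → a ≡ b
ι-injective a b eq = cong ↥_ (trans (sym (ι≡mkℚ a)) (trans eq (ι≡mkℚ b)))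

ι-+ : ∀ a b → ι a ℚ.+ ι b ≡ ι (a + b)
ι-+ a b = trans (cong₂ ℚ._+_ (ι≡mkℚ a) (ι≡mkℚ b))
  (cong ι (cong₂ _+_ (ℤ.*-identityʳ a) (ℤ.*-identityʳ b)))

ι-* : ∀ a b → ι a ℚ.* ι b ≡ ι (a * b)
ι-* a b = cong₂ ℚ._*_ (ι≡mkℚ a) (ι≡mkℚ b)

ι-neg : ∀ a → ℚ.- ι a ≡ ι (- a)
ι-neg a = trans (solve 1 (λ p → :- p := con (ι (- 1ℤ)) :* p) refl (ι a))
  (trans (ι-* (- 1ℤ) a) (cong ι (ℤ.-1*i≡-i a)))
  where open +-*-Solver

ι-sum : ∀ {n} (f : Vector ℤ n) → sumℚ (ι ∘ f) ≡ ι (sumℤ f)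
ι-sum {zero}  f = refl
ι-sum {suc n} f = trans (cong (ι (f zero) ℚ.+_) (ι-sum (f ∘ suc))) (ι-+ (f zero) _)

ι-mono-< : ∀ {a b} → a ℤ.< b → ι a ℚ.< ι b
ι-mono-< {a} {b} a<b = subst₂ ℚ._<_ (sym (ι≡mkℚ a)) (sym (ι≡mkℚ b))
  (ℚ.*<* (subst₂ ℤ._<_ (sym (ℤ.*-identityʳ a)) (sym (ℤ.*-identityʳ b)) a<b))

ι-cancel-≤ : ∀ a b → ι a ℚ.≤ ι b → a ℤ.≤ b
ι-cancel-≤ a b ιa≤ιb = subst₂ ℤ._≤_ (ℤ.*-identityʳ a) (ℤ.*-identityʳ b)
  (ℚ.drop-*≤* (subst₂ ℚ._≤_ (ι≡mkℚ a) (ι≡mkℚ b) ιa≤ιb))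

m*[a/m]≡a : ∀ m .{{_ : NonZero m}} a → ι (+ m) ℚ.* (a / m) ≡ ι a
m*[a/m]≡a m@(suc m-1) a = ℚ.toℚᵘ-injective (begin
  toℚᵘ (ι (+ m) ℚ.* (a / m))            ≈⟨ ℚ.toℚᵘ-homo-* (ι (+ m)) (a / m) ⟩
  toℚᵘ (ι (+ m)) ℚᵘ.* toℚᵘ (a / m)      ≈⟨ ℚᵘ.*-cong (ℚ.toℚᵘ-fromℚᵘ (mkℚᵘ (+ m) 0)) (ℚ.toℚᵘ-fromℚᵘ (mkℚᵘ a m-1)) ⟩
  mkℚᵘ (+ m) 0 ℚᵘ.* mkℚᵘ a m-1          ≈⟨ *≡* (trans (ring (+ m) a) (cong (λ n → a * + n) (sym (ℕ.*-identityˡ m)))) ⟩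
  mkℚᵘ a 0                              ≈⟨ ℚ.toℚᵘ-fromℚᵘ (mkℚᵘ a 0) ⟨
  toℚᵘ (ι a)                            ∎)
  where
  open ℚᵘ.≃-Reasoning
  ring : ∀ m a → m * a * 1ℤ ≡ a * m
  ring = ℤ-Solver.solve-∀

*-cancelˡ-ι : ∀ m .{{_ : NonZero m}} {x y} → ι (+ m) ℚ.* x ≡ ι (+ m) ℚ.* y → x ≡ y
*-cancelˡ-ι m {x} {y} eq = trans (sym (unscale x)) (trans (cong ((1ℤ / m) ℚ.*_) eq) (unscale y))
  where
  unscale : ∀ x → (1ℤ / m) ℚ.* (ι (+ m) ℚ.* x) ≡ x
  unscale x = trans (sym (ℚ.*-assoc (1ℤ / m) (ι (+ m)) x))
    (trans (cong (ℚ._* x) (trans (ℚ.*-comm (1ℤ / m) (ι (+ m))) (m*[a/m]≡a m 1ℤ))) (ℚ.*-identityˡ x))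

∣⇒integral : ∀ {m} q → ↧ₙ q ∣ m → ∃ λ z → ι (+ m) ℚ.* q ≡ ι z
∣⇒integral q@record{} (divides k refl) = + k * ↥ q , (begin
  ι (+ (k ℕ.* ↧ₙ q)) ℚ.* q           ≡⟨ cong (λ s → ι s ℚ.* q) (ℤ.pos-* k (↧ₙ q)) ⟩
  ι (+ k * ↧ q) ℚ.* q                ≡⟨ cong (ℚ._* q) (ι-* (+ k) (↧ q)) ⟨
  ι (+ k) ℚ.* ι (↧ q) ℚ.* q          ≡⟨ ℚ.*-assoc (ι (+ k)) (ι (↧ q)) q ⟩
  ι (+ k) ℚ.* (ι (↧ q) ℚ.* q)        ≡⟨ cong (λ p → ι (+ k) ℚ.* (ι (↧ q) ℚ.* p)) (ℚ.↥p/↧p≡p q) ⟨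
  ι (+ k) ℚ.* (ι (↧ q) ℚ.* (↥ q / ↧ₙ q)) ≡⟨ cong (ι (+ k) ℚ.*_) (m*[a/m]≡a (↧ₙ q) (↥ q)) ⟩
  ι (+ k) ℚ.* ι (↥ q)                ≡⟨ ι-* (+ k) (↥ q) ⟩
  ι (+ k * ↥ q)                      ∎)
  where open ≡-Reasoning

frac-id : ∀ {q} → 0ℚ ℚ.≤ q → q ℚ.< 1ℚ → frac q ≡ q
frac-id {q@(mkℚ (+ m) e _)} 0≤q (ℚ.*<* q<1) =
  trans (cong (λ z → q ℚ.- ι z) floor≡0) (ℚ.+-identityʳ q)
  where
  m<1+e : m ℕ.< suc e
  m<1+e = ℤ.drop‿+<+ (subst₂ ℤ._<_ (ℤ.*-identityʳ (+ m)) (ℤ.*-identityˡ (+ suc e)) q<1)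
  floor≡0 : floor q ≡ 0ℤ
  floor≡0 = trans (ℤ.div-pos-is-/ℕ (+ m) (suc e)) (cong +_ (m<n⇒m/n≡0 m<1+e))
frac-id {mkℚ -[1+ _ ] _ _} (ℚ.*≤* ()) _

0≤a/m : ∀ a m .{{_ : NonZero m}} → 0ℚ ℚ.≤ + a / m
0≤a/m a m = ℚ.nonNegative⁻¹ (+ a / m) {{ℚ.normalize-nonNeg a m}}

a/m<1 : ∀ {a} m .{{_ : NonZero m}} → a ℕ.< m → + a / m ℚ.< 1ℚ
a/m<1 {a} m a<m = ℚ.*-cancelˡ-<-nonNeg (ι (+ m)) {{ℚ.normalize-nonNeg m 1}}
  (subst₂ ℚ._<_ (sym (m*[a/m]≡a m (+ a))) (sym (ℚ.*-identityʳ (ι (+ m)))) (ι-mono-< (ℤ.+<+ a<m)))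

height≡1⇒ : ∀ {m n} .{{_ : NonZero m}} (w : Word m n) → height w ≡ 1ℚ → sumℕ (toℕ ∘ w) ≡ m
height≡1⇒ {m} w eq = ℤ.+-injective (ι-injective (+ sumℕ (toℕ ∘ w)) (+ m)
  (trans (sym (m*[a/m]≡a m (+ sumℕ (toℕ ∘ w))))
    (trans (cong (ι (+ m) ℚ.*_) eq) (ℚ.*-identityʳ (ι (+ m))))))

height≡1⇐ : ∀ {m n} .{{_ : NonZero m}} (w : Word m n) → sumℕ (toℕ ∘ w) ≡ m → height w ≡ 1ℚ
height≡1⇐ {m} w eq = *-cancelˡ-ι m
  (trans (m*[a/m]≡a m (+ sumℕ (toℕ ∘ w)))
    (trans (cong (ι ∘ +_) eq) (sym (ℚ.*-identityʳ (ι (+ m))))))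

clear-denominators : ∀ {n} m (x : Vector ℚ n) (y : Vector ℤ n) →
  (∀ i → ι m ℚ.* x i ≡ ι (y i)) →
  ∀ v → ι m ℚ.* sumℚ (λ i → x i ℚ.* ι (v i)) ≡ ι (y ∙ v)
clear-denominators m x y eq v = begin
  ι m ℚ.* sumℚ (λ i → x i ℚ.* ι (v i))        ≡⟨ ∑ℚ.*-distribˡ-sum (ι m) (λ i → x i ℚ.* ι (v i)) ⟩
  sumℚ (λ i → ι m ℚ.* (x i ℚ.* ι (v i)))      ≡⟨ ∑ℚ.sum-cong-≗ (λ i → sym (ℚ.*-assoc (ι m) (x i) (ι (v i)))) ⟩
  sumℚ (λ i → ι m ℚ.* x i ℚ.* ι (v i))        ≡⟨ ∑ℚ.sum-cong-≗ (λ i → trans (cong (ℚ._* ι (v i)) (eq i)) (ι-* (y i) (v i))) ⟩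
  sumℚ (λ i → ι (y i * v i))                  ≡⟨ ι-sum (λ i → y i * v i) ⟩
  ι (y ∙ v)                                   ∎
  where open ≡-Reasoning

sum-++ : ∀ m {n} (f : Vector ℤ (m ℕ.+ n)) →
         sumℤ f ≡ sumℤ (λ i → f (i ↑ˡ n)) + sumℤ (λ i → f (m ↑ʳ i))
sum-++ zero    f = sym (ℤ.+-identityˡ _)
sum-++ (suc m) f = trans (cong (_+_ (f zero)) (sum-++ m (f ∘ suc))) (sym (ℤ.+-assoc (f zero) _ _))

pos-sum : ∀ {n} (f : Vector ℕ n) → + sumℕ f ≡ sumℤ (+_ ∘ f)
pos-sum {zero}  f = refl
pos-sum {suc n} f = trans (ℤ.pos-+ (f zero) _) (cong (_+_ (+ f zero)) (pos-sum (f ∘ suc)))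

δ : ∀ {n} → Fin n → Vector ℕ n
δ zero    = 1 ∷ λ _ → 0
δ (suc i) = 0 ∷ δ i

δ-∙ : ∀ {n} i (v : Vector ℤ n) → (+_ ∘ δ i) ∙ v ≡ v i
δ-∙ zero    v = trans (cong₂ _+_ (ℤ.*-identityˡ (v zero)) (∙-zeroˡ (v ∘ suc))) (ℤ.+-identityʳ (v zero))
δ-∙ (suc i) v = trans (ℤ.+-identityˡ _) (δ-∙ i (v ∘ suc))

f≤sum : ∀ {n} (f : Vector ℕ n) i → f i ℕ.≤ sumℕ f
f≤sum f zero    = ℕ.m≤m+n _ _
f≤sum f (suc i) = ℕ.≤-trans (f≤sum (f ∘ suc) i) (ℕ.m≤n+m _ _)

concentrated : ∀ {m n} (f : Vector ℕ n) → sumℕ f ≡ m → ∀ p → m ℕ.≤ f p → ∀ i → f i ≡ 0 ⊎ f i ≡ m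
concentrated {m} {suc n} f sum≡m p m≤fp i with p ≟F i
... | yes refl = inj₂ (ℕ.≤-antisym (subst (f p ℕ.≤_) sum≡m (f≤sum f p)) m≤fp)
... | no  p≢i  = inj₁ (ℕ.n≤0⇒n≡0 (subst (ℕ._≤ 0) (cong f (punchIn-punchOut p≢i))
  (subst (f (punchIn p (punchOut p≢i)) ℕ.≤_) rest≡0 (f≤sum rest (punchOut p≢i)))))
  where
  rest : Vector ℕ n
  rest = removeAt f p
  rest≡0 : sumℕ rest ≡ 0
  rest≡0 = ℕ.n≤0⇒n≡0 (ℕ.+-cancelˡ-≤ (f p) (sumℕ rest) 0 (ℕ.≤-trans
    (ℕ.≤-reflexive (trans (sym (∑ℕ.sum-remove {i = p} f)) sum≡m))
    (ℕ.≤-trans m≤fp (ℕ.≤-reflexive (sym (ℕ.+-identityʳ (f p)))))))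

enumerate : ∀ {m n} {P : Pred (Word m n) 0ℓ} → Decidable P → (∀ {u w} → u ≗ w → P u → P w) →
  ∃ λ k → ∃ λ (g : Vector (Word m n) k) → (∀ j → P (g j)) × (∀ w → P w → ∃ λ j → g j ≗ w)
enumerate {m} {n} {P} P? resp =
  length codes , word ∘ lookup codes ,
  (λ j → All.lookup (all-filter (P? ∘ word) (allFin (m ℕ.^ n))) (∈-lookup j)) ,
  λ w Pw →
    let w∈codes = ∈-filter⁺ (P? ∘ word) (∈-allFin (funToFin w)) (resp (sym ∘ finToFun-funToFin w) Pw)
    in index w∈codes , λ i →
      trans (cong (λ e → word e i) (sym (lookup-index w∈codes))) (finToFun-funToFin w i)
  where
  word : Fin (m ℕ.^ n) → Word m n
  word = finToFun
  codes : List (Fin (m ℕ.^ n))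
  codes = filter (P? ∘ word) (allFin (m ℕ.^ n))

⟦_⟧ : ∀ {m n} → Word m n → Vector ℤ n
⟦ w ⟧ i = + toℕ (w i)

-- Words modulo m

module Modulo (m : ℕ) .{{_ : NonZero m}} where

  infix 4 _≈_
  record _≈_ (a b : ℤ) : Set where
    constructor _,_
    field
      quotient : ℤ
      equality : a ≡ b + quotient * + m
  open _≈_ public

  ≈-reflexive : ∀ {a b} → a ≡ b → a ≈ b
  ≈-reflexive {a} refl = 0ℤ , sym (ℤ.+-identityʳ a)

  ≈-sym : ∀ {a b} → a ≈ b → b ≈ a
  ≈-sym {b = b} (t , eq) = - t , trans (ring b t (+ m)) (cong (λ a → a + - t * + m) (sym eq))
    where
    ring : ∀ b t m → b ≡ b + t * m + - t * m
    ring = ℤ-Solver.solve-∀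

  ≈-trans : ∀ {a b c} → a ≈ b → b ≈ c → a ≈ c
  ≈-trans {c = c} (s , refl) (t , refl) = t + s , ring c s t (+ m)
    where
    ring : ∀ c s t m → c + t * m + s * m ≡ c + (t + s) * m
    ring = ℤ-Solver.solve-∀

  +-cong-≈ : ∀ {a b c d} → a ≈ b → c ≈ d → a + c ≈ b + d
  +-cong-≈ {b = b} {d = d} (s , refl) (t , refl) = s + t , ring b d s t (+ m)
    where
    ring : ∀ b d s t m → b + s * m + (d + t * m) ≡ b + d + (s + t) * m
    ring = ℤ-Solver.solve-∀

  *-cong-≈ : ∀ {a b c d} → a ≈ b → c ≈ d → a * c ≈ b * d
  *-cong-≈ {b = b} {d = d} (s , refl) (t , refl) = b * t + s * d + s * t * + m , ring b d s t (+ m)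
    where
    ring : ∀ b d s t m → (b + s * m) * (d + t * m) ≡ b * d + (b * t + s * d + s * t * m) * m
    ring = ℤ-Solver.solve-∀

  ∙-congˡ-≈ : ∀ {n} {u v : Vector ℤ n} → (∀ i → u i ≈ v i) → ∀ w → u ∙ w ≈ v ∙ w
  ∙-congˡ-≈ {zero}  _   _ = ≈-reflexive refl
  ∙-congˡ-≈ {suc n} u≈v w = +-cong-≈
    (*-cong-≈ (u≈v zero) (≈-reflexive (refl {x = w zero}))) (∙-congˡ-≈ (u≈v ∘ suc) (w ∘ suc))

  ∙-congʳ-≈ : ∀ {n} (u : Vector ℤ n) {v w} → (∀ i → v i ≈ w i) → u ∙ v ≈ u ∙ w
  ∙-congʳ-≈ u {v} {w} v≈w = ≈-trans (≈-reflexive (∙-comm u v))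
    (≈-trans (∙-congˡ-≈ v≈w u) (≈-reflexive (∙-comm w u)))

  _≈0? : ∀ a → Dec (a ≈ 0ℤ)
  a ≈0? = map′
    (λ (ℤ.divides t eq) → t , trans eq (sym (ℤ.+-identityˡ _)))
    (λ (t , eq) → ℤ.divides t (trans eq (ℤ.+-identityˡ _)))
    (+ m ℤ.∣? a)

  residue : ℤ → Fin m
  residue a = fromℕ< (ℤ.n%ℕd<d a m)

  residue-≈ : ∀ a → a ≈ + toℕ (residue a)
  residue-≈ a = a ℤ./ℕ m , trans (ℤ.a≡a%ℕn+[a/ℕn]*n a m)
    (cong (λ r → + r + (a ℤ./ℕ m) * + m) (sym (toℕ-fromℕ< (ℤ.n%ℕd<d a m))))

  mod-≈ : ∀ a → + a ≈ + toℕ (a mod m)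
  mod-≈ a = + (a ℕ./ m) , (begin
    + a                                  ≡⟨ cong +_ (m≡m%n+[m/n]*n a m) ⟩
    + (a ℕ.% m ℕ.+ a ℕ./ m ℕ.* m)        ≡⟨ ℤ.pos-+ (a ℕ.% m) (a ℕ./ m ℕ.* m) ⟩
    + (a ℕ.% m) + + (a ℕ./ m ℕ.* m)      ≡⟨ cong₂ _+_ (cong +_ (sym (toℕ-fromℕ< (m%n<n a m)))) (ℤ.pos-* (a ℕ./ m) m) ⟩
    + toℕ (a mod m) + + (a ℕ./ m) * + m  ∎)
    where open ≡-Reasoning

  toℕ-injective-≈ : ∀ {c e : Fin m} → + toℕ c ≈ + toℕ e → c ≡ e
  toℕ-injective-≈ {c} {e} (+ t , eq) = toℕ-injective (small c e t eq)
    where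
    small : ∀ (c e : Fin m) t → + toℕ c ≡ + toℕ e + + t * + m → toℕ c ≡ toℕ e
    small c e t eq = begin
      toℕ c                        ≡⟨ m<n⇒m%n≡m (toℕ<n c) ⟨
      toℕ c ℕ.% m                  ≡⟨ cong (ℕ._% m) (ℤ.+-injective c≡e+tm) ⟩
      (toℕ e ℕ.+ t ℕ.* m) ℕ.% m    ≡⟨ [m+kn]%n≡m%n (toℕ e) t m ⟩
      toℕ e ℕ.% m                  ≡⟨ m<n⇒m%n≡m (toℕ<n e) ⟩
      toℕ e                        ∎
      where
      open ≡-Reasoning
      c≡e+tm : + toℕ c ≡ + (toℕ e ℕ.+ t ℕ.* m)
      c≡e+tm = trans eq (trans (cong (_+_ (+ toℕ e)) (sym (ℤ.pos-* t m))) (sym (ℤ.pos-+ (toℕ e) (t ℕ.* m))))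
  toℕ-injective-≈ {c} {e} (-[1+ t ] , eq) =
    sym (toℕ-injective-≈ {e} {c} (+ suc t , equality (≈-sym (-[1+ t ] , eq))))

  linearCombination-≈ : ∀ {n k} (a : Vector (Fin m) k) (g : Vector (Word m n) k) i →
    ⟦ linearCombination a g ⟧ i ≈ ⟦ a ⟧ ∙ (λ j → ⟦ g j ⟧ i)
  linearCombination-≈ a g i = ≈-trans (≈-sym (mod-≈ (sumℕ (λ j → toℕ (a j) ℕ.* toℕ (g j i)))))
    (≈-reflexive (trans (pos-sum (λ j → toℕ (a j) ℕ.* toℕ (g j i)))
      (∑ℤ.sum-cong-≗ (λ j → ℤ.pos-* (toℕ (a j)) (toℕ (g j i))))))

  Span : ∀ {n k} → Vector (Word m n) k → Pred (Vector ℤ n) 0ℓ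
  Span g u = ∃ λ b → ∀ i → u i ≈ b ∙ (λ j → ⟦ g j ⟧ i)

  span-row : ∀ {n k} (g : Vector (Word m n) k) j → Span g ⟦ g j ⟧
  span-row g j = (+_ ∘ δ j) , λ i → ≈-reflexive (sym (δ-∙ j (λ l → ⟦ g l ⟧ i)))

  span-zero : ∀ {n k} (g : Vector (Word m n) k) → Span g (λ _ → 0ℤ)
  span-zero g = (λ _ → 0ℤ) , λ i → ≈-reflexive (sym (∙-zeroˡ (λ j → ⟦ g j ⟧ i)))

  span-resp-≈ : ∀ {n k} {g : Vector (Word m n) k} {u v} → (∀ i → u i ≈ v i) → Span g v → Span g u
  span-resp-≈ u≈v (b , v≈b) = b , λ i → ≈-trans (u≈v i) (v≈b i)

  span-combination : ∀ {n k l} {g : Vector (Word m n) k} (a : Vector ℤ l) (Y : Vector (Vector ℤ n) l) →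
    (∀ j → Span g (Y j)) → Span g (λ i → a ∙ column Y i)
  span-combination {g = g} a Y Y∈span =
    (λ l → a ∙ column B l) , λ i → ≈-trans
      (∙-congʳ-≈ a (λ j → proj₂ (Y∈span j) i))
      (≈-reflexive (sym (∙-assoc a B (λ l → ⟦ g l ⟧ i))))
    where
    B = λ j → proj₁ (Y∈span j)

  span⇒linearCombination : ∀ {n k} {g : Vector (Word m n) k} {w} →
    Span g ⟦ w ⟧ → ∃ λ a → ∀ i → w i ≡ linearCombination a g i
  span⇒linearCombination {g = g} (b , w≈b) = residue ∘ b , λ i → toℕ-injective-≈
    (≈-trans (w≈b i) (≈-trans
      (∙-congˡ-≈ (λ j → residue-≈ (b j)) (λ j → ⟦ g j ⟧ i))
      (≈-sym (linearCombination-≈ (residue ∘ b) g i))))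

  linearCombination⇒span : ∀ {n k} {g : Vector (Word m n) k} {w : Word m n} a →
    (∀ i → w i ≡ linearCombination a g i) → ∀ i → ⟦ w ⟧ i ≈ ⟦ a ⟧ ∙ (λ j → ⟦ g j ⟧ i)
  linearCombination⇒span {g = g} a w≡ag i =
    ≈-trans (≈-reflexive (cong (+_ ∘ toℕ) (w≡ag i))) (linearCombination-≈ a g i)

-- Codewords and lattice points

module _ {d : ℕ} (Δ : LatticeSimplex d) where

  open Modulo (N Δ)

  hat : Vector (Vector ℤ (suc d)) (suc d)
  hat i = 1ℤ ∷ vertex Δ i

  hat-independent : Independent hat
  hat-independent c c∙hat≡0 i = ι-injective (c i) 0ℤ (affinelyIndependent Δ (ι ∘ c)
    (trans (ι-sum c) (cong ι (trans (sym (∙-identityʳ c)) (c∙hat≡0 zero))))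
    (λ k → trans (∑ℚ.sum-cong-≗ (λ i → ι-* (c i) (vertex Δ i k)))
      (trans (ι-sum (λ i → c i * vertex Δ i k)) (cong ι (c∙hat≡0 (suc k)))))
    i)

  frac-combination : ∀ (x : Vector ℚ (suc d)) v z → sumℚ (λ i → x i ℚ.* ι (v i)) ≡ ι z →
    sumℚ (λ i → frac (x i) ℚ.* ι (v i)) ≡ ι (z + (λ i → - floor (x i)) ∙ v)
  frac-combination x v z eq = begin
    sumℚ (λ i → frac (x i) ℚ.* ι (v i))
      ≡⟨ ∑ℚ.sum-cong-≗ (λ i → trans (ℚ.*-distribʳ-+ (ι (v i)) (x i) (ℚ.- ι (floor (x i))))
           (cong (x i ℚ.* ι (v i) ℚ.+_)
             (trans (cong (ℚ._* ι (v i)) (ι-neg (floor (x i)))) (ι-* (- floor (x i)) (v i))))) ⟩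
    sumℚ (λ i → x i ℚ.* ι (v i) ℚ.+ ι (- floor (x i) * v i))
      ≡⟨ ∑ℚ.∑-distrib-+ (λ i → x i ℚ.* ι (v i)) (λ i → ι (- floor (x i) * v i)) ⟩
    sumℚ (λ i → x i ℚ.* ι (v i)) ℚ.+ sumℚ (λ i → ι (- floor (x i) * v i))
      ≡⟨ cong₂ ℚ._+_ eq (ι-sum (λ i → - floor (x i) * v i)) ⟩
    ι z ℚ.+ ι ((λ i → - floor (x i)) ∙ v)
      ≡⟨ ι-+ z _ ⟩
    ι (z + (λ i → - floor (x i)) ∙ v) ∎
    where open ≡-Reasoning

  Λ-intro : ∀ x q → (∀ k → sumℚ (λ i → frac (x i) ℚ.* ι (hat i k)) ≡ ι (q k)) → Λ Δ x
  Λ-intro x q eq = mkΛ (q ∘ suc) (q zero) (eq ∘ suc) (eq zero)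

  Λ-elim : ∀ x → Λ Δ x → ∃ λ q → ∀ k → sumℚ (λ i → frac (x i) ℚ.* ι (hat i k)) ≡ ι (q k)
  Λ-elim x (mkΛ q h eqs eq) = (h ∷ q) , λ { zero → eq ; (suc k) → eqs k }

  integral-multiple : ∀ (x : Vector ℚ (suc d)) (q : Vector ℤ (suc d)) →
    (∀ k → sumℚ (λ i → x i ℚ.* ι (hat i k)) ≡ ι (q k)) →
    ∃ λ y → (∀ i → ι (+ N Δ) ℚ.* x i ≡ ι (y i)) × (∀ k → y ∙ column hat k ≡ + N Δ * q k)
  integral-multiple x q eq = y , Nx≡y , λ k → ι-injective (y ∙ column hat k) (+ N Δ * q k)
    (trans (sym (clear-denominators (+ N Δ) x y Nx≡y (column hat k)))
      (trans (cong (ι (+ N Δ) ℚ.*_) (eq k)) (ι-* (+ N Δ) (q k))))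
    where
    x∈Λ : Λ Δ x
    x∈Λ = Λ-intro x (λ k → q k + (λ i → - floor (x i)) ∙ column hat k)
      (λ k → frac-combination x (column hat k) (q k) (eq k))
    integral : ∀ i → ∃ λ z → ι (+ N Δ) ℚ.* x i ≡ ι z
    integral i = ∣⇒integral (x i) (IsLCM.commonMultiple (N-isLCM Δ) (x , x∈Λ , i , refl))
    y = proj₁ ∘ integral
    Nx≡y = proj₂ ∘ integral

  Divisible : Pred (Vector ℤ (suc d)) 0ℓ
  Divisible y = ∀ k → y ∙ column hat k ≈ 0ℤ

  Divisible-resp-≈ : ∀ u v → (∀ i → u i ≈ v i) → Divisible v → Divisible u
  Divisible-resp-≈ u v u≈v v∈ k = ≈-trans (∙-congˡ-≈ u≈v (column hat k)) (v∈ k)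

  Divisible-combination : ∀ {l} (a : Vector ℤ l) Y → (∀ j → Divisible (Y j)) →
    Divisible (λ i → a ∙ column Y i)
  Divisible-combination a Y Y∈ k = ≈-trans (≈-reflexive (∙-assoc a Y (column hat k)))
    (≈-trans (∙-congʳ-≈ a (λ j → Y∈ j k)) (≈-reflexive (∙-zeroʳ a)))

  multiple⇒≈0 : ∀ {a} q → a ≡ + N Δ * q → a ≈ 0ℤ
  multiple⇒≈0 q eq = q , trans eq (trans (ℤ.*-comm (+ N Δ) q) (sym (ℤ.+-identityˡ _)))

  ≈0⇒multiple : ∀ {a} (p : a ≈ 0ℤ) → a ≡ + N Δ * quotient p
  ≈0⇒multiple (q , eq) = trans eq (trans (ℤ.+-identityˡ _) (ℤ.*-comm q (+ N Δ)))

  code⇒divisible : ∀ c → Code Δ c → Divisible ⟦ c ⟧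
  code⇒divisible c (x , x∈Λ , Nx≡c) k =
    let q , eq = Λ-elim x x∈Λ in
    multiple⇒≈0 (q k) (ι-injective (⟦ c ⟧ ∙ column hat k) (+ N Δ * q k)
      (trans (sym (clear-denominators (+ N Δ) (frac ∘ x) ⟦ c ⟧ Nx≡c (column hat k)))
        (trans (cong (ι (+ N Δ) ℚ.*_) (eq k)) (ι-* (+ N Δ) (q k)))))

  divisible⇒code : ∀ c → Divisible ⟦ c ⟧ → Code Δ c
  divisible⇒code c c∈ = x , Λ-intro x (λ k → quotient (c∈ k)) integral , Nx≡c
    where
    x : Vector ℚ (suc d)
    x i = ⟦ c ⟧ i / N Δ
    Nx≡c : ∀ i → ι (+ N Δ) ℚ.* frac (x i) ≡ ι (⟦ c ⟧ i)
    Nx≡c i = trans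
      (cong (ι (+ N Δ) ℚ.*_) (frac-id (0≤a/m (toℕ (c i)) (N Δ)) (a/m<1 (N Δ) (toℕ<n (c i)))))
      (m*[a/m]≡a (N Δ) (⟦ c ⟧ i))
    integral : ∀ k → sumℚ (λ i → frac (x i) ℚ.* ι (hat i k)) ≡ ι (quotient (c∈ k))
    integral k = *-cancelˡ-ι (N Δ) (trans
      (clear-denominators (+ N Δ) (frac ∘ x) ⟦ c ⟧ Nx≡c (column hat k))
      (trans (cong ι (≈0⇒multiple (c∈ k))) (sym (ι-* (+ N Δ) (quotient (c∈ k))))))

  latticePoint : ∀ m .{{_ : NonZero m}} (n : Vector ℕ (suc d)) p →
    (∀ k → (+_ ∘ n) ∙ column hat k ≡ + m * (1ℤ ∷ p) k) → LatticePoint Δ p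
  latticePoint m n p eq = record
    { coordinate  = x
    ; nonNegative = λ i → 0≤a/m (n i) m
    ; total       = trans (∑ℚ.sum-cong-≗ (λ i → sym (ℚ.*-identityʳ (x i)))) (combination zero)
    ; combination = combination ∘ suc
    }
    where
    x : Vector ℚ (suc d)
    x i = + n i / m
    combination : ∀ k → sumℚ (λ i → x i ℚ.* ι (hat i k)) ≡ ι ((1ℤ ∷ p) k)
    combination k = *-cancelˡ-ι m (trans
      (clear-denominators (+ m) x (+_ ∘ n) (λ i → m*[a/m]≡a m (+ n i)) (column hat k))
      (trans (cong ι (eq k)) (sym (ι-* (+ m) ((1ℤ ∷ p) k)))))

  vertex-latticePoint : ∀ i → LatticePoint Δ (vertex Δ i)
  vertex-latticePoint i = latticePoint 1 (δ i) (vertex Δ i)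
    (λ k → trans (δ-∙ i (column hat k)) (sym (ℤ.*-identityˡ (hat i k))))

  scaled-coordinates : ∀ {p} → LatticePoint Δ p →
    ∃ λ (n : Vector ℕ (suc d)) → ∀ k → (+_ ∘ n) ∙ column hat k ≡ + N Δ * (1ℤ ∷ p) k
  scaled-coordinates {p} P =
    let y , Nx≡y , y∙hat = integral-multiple coordinate (1ℤ ∷ p) λ where
          zero    → trans (∑ℚ.sum-cong-≗ (λ i → ℚ.*-identityʳ (coordinate i))) total
          (suc k) → combination k
        0≤y = λ i → ι-cancel-≤ 0ℤ (y i) (subst₂ ℚ._≤_ (ℚ.*-zeroʳ (ι (+ N Δ))) (Nx≡y i)
          (ℚ.*-monoˡ-≤-nonNeg (ι (+ N Δ)) {{ℚ.normalize-nonNeg (N Δ) 1}} (nonNegative i)))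
    in ℤ.∣_∣ ∘ y , λ k → trans
      (∙-congˡ (λ i → ℤ.0≤i⇒+∣i∣≡i (0≤y i)) (column hat k)) (y∙hat k)
    where open LatticePoint P

  scaled-sum : ∀ {p} (n : Vector ℕ (suc d)) →
    (∀ k → (+_ ∘ n) ∙ column hat k ≡ + N Δ * (1ℤ ∷ p) k) → sumℕ n ≡ N Δ
  scaled-sum n eq = ℤ.+-injective (trans (pos-sum n)
    (trans (sym (∙-identityʳ (+_ ∘ n))) (trans (eq zero) (ℤ.*-identityʳ (+ N Δ)))))

  HeightOneCodeword : Pred (Word (N Δ) (suc d)) 0ℓ
  HeightOneCodeword w = Divisible ⟦ w ⟧ × sumℕ (toℕ ∘ w) ≡ N Δ

  heightOneCodeword? : Decidable HeightOneCodeword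
  heightOneCodeword? w = all? (λ k → (⟦ w ⟧ ∙ column hat k) ≈0?) ×-dec (sumℕ (toℕ ∘ w) ℕ.≟ N Δ)

  heightOneCodeword-resp : ∀ {u w} → u ≗ w → HeightOneCodeword u → HeightOneCodeword w
  heightOneCodeword-resp {u} {w} u≗w (u∈ , sum≡N) =
    Divisible-resp-≈ ⟦ w ⟧ ⟦ u ⟧ (λ i → ≈-reflexive (cong (+_ ∘ toℕ) (sym (u≗w i)))) u∈ ,
    trans (∑ℕ.sum-cong-≗ (λ i → cong toℕ (sym (u≗w i)))) sum≡N

  heightOne-latticePoint : ∀ w → HeightOneCodeword w →
    ∃ λ p → LatticePoint Δ p × (∀ k → ⟦ w ⟧ ∙ column hat k ≡ + N Δ * (1ℤ ∷ p) k)
  heightOne-latticePoint w (w∈ , sum≡N) = p , latticePoint (N Δ) (toℕ ∘ w) p w∙hat , w∙hat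
    where
    p : Vector ℤ d
    p k = quotient (w∈ (suc k))
    w∙hat : ∀ k → ⟦ w ⟧ ∙ column hat k ≡ + N Δ * (1ℤ ∷ p) k
    w∙hat zero    = trans (∙-identityʳ ⟦ w ⟧) (trans (sym (pos-sum (toℕ ∘ w)))
      (trans (cong +_ sum≡N) (sym (ℤ.*-identityʳ (+ N Δ)))))
    w∙hat (suc k) = ≈0⇒multiple (w∈ (suc k))

  -- The barycentric coordinates of a lattice point, times N, are a word of
  -- height one, unless the point is a vertex: then they vanish modulo N.
  latticePoint-span : ∀ {k} (g : Vector (Word (N Δ) (suc d)) k) →
    (∀ w → HeightOneCodeword w → ∃ λ j → g j ≗ w) →
    ∀ p n → (∀ k → (+_ ∘ n) ∙ column hat k ≡ + N Δ * (1ℤ ∷ p) k) → Span g (+_ ∘ n)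
  latticePoint-span g complete p n eq with all? (λ i → n i ℕ.<? N Δ)
  ... | yes n<N =
    let j , gj≗w = complete w
          ( Divisible-resp-≈ ⟦ w ⟧ (+_ ∘ n) (λ i → ≈-reflexive (w≡n i)) (λ k → multiple⇒≈0 ((1ℤ ∷ p) k) (eq k))
          , trans (∑ℕ.sum-cong-≗ (λ i → toℕ-fromℕ< (n<N i))) (scaled-sum {p} n eq) )
    in span-resp-≈ (λ i → ≈-reflexive (sym (trans (cong (+_ ∘ toℕ) (gj≗w i)) (w≡n i)))) (span-row g j)
    where
    w : Word (N Δ) (suc d)
    w i = fromℕ< (n<N i)
    w≡n : ∀ i → ⟦ w ⟧ i ≡ + n i
    w≡n i = cong +_ (toℕ-fromℕ< (n<N i))
  ... | no n≮N =
    let i , ni≮N = ¬∀⟶∃¬ (suc d) _ (λ i → n i ℕ.<? N Δ) n≮N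
        0∨N = concentrated n (scaled-sum {p} n eq) i (ℕ.≮⇒≥ ni≮N)
    in span-resp-≈ (λ i → vanishes (0∨N i)) (span-zero g)
    where
    vanishes : ∀ {a} → a ≡ 0 ⊎ a ≡ N Δ → + a ≈ 0ℤ
    vanishes (inj₁ refl) = ≈-reflexive refl
    vanishes (inj₂ refl) = multiple⇒≈0 1ℤ (sym (ℤ.*-identityʳ (+ N Δ)))

  spanning⇒generated : Spanning Δ →
    ∃ λ (k : ℕ) → ∃ λ (g : Vector (Word (N Δ) (suc d)) k) →
    (Code Δ GeneratedBy g) × (∀ j → height (g j) ≡ 1ℚ)
  spanning⇒generated spanning
    with k , g , sound , complete ← enumerate heightOneCodeword? heightOneCodeword-resp =
    k , g , (λ c → mk⇔ (generates c) (λ (a , eq) → divisible⇒code c (Divisible-resp-≈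
        ⟦ c ⟧ (λ i → ⟦ a ⟧ ∙ column (⟦_⟧ ∘ g) i) (linearCombination⇒span {g = g} {c} a eq)
        (Divisible-combination ⟦ a ⟧ (⟦_⟧ ∘ g) (proj₁ ∘ sound))))) ,
    λ j → height≡1⇐ (g j) (proj₂ (sound j))
    where
    generates : ∀ c → Code Δ c → ∃ λ a → ∀ i → c i ≡ linearCombination a g i
    generates c c∈Code
      with l , p , a , P , q≡ , h≡ ← spanning (λ k → quotient (code⇒divisible c c∈Code (suc k)))
                                             (quotient (code⇒divisible c c∈Code zero)) =
      span⇒linearCombination (span-resp-≈ (λ i → ≈-reflexive (c≡ay i))
        (span-combination a Y (λ j → latticePoint-span g complete (p j) (n j) (n∙hat j))))
      where
      n = λ j → proj₁ (scaled-coordinates (P j))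
      n∙hat = λ j → proj₂ (scaled-coordinates (P j))
      Y : Vector (Vector ℤ (suc d)) l
      Y j i = + n j i
      q≡a∙p̂ : ∀ k → quotient (code⇒divisible c c∈Code k) ≡ a ∙ column (λ j → 1ℤ ∷ p j) k
      q≡a∙p̂ zero    = sym h≡
      q≡a∙p̂ (suc k) = sym (q≡ k)
      c∙hat≡ : ∀ k → ⟦ c ⟧ ∙ column hat k ≡ (λ i → a ∙ column Y i) ∙ column hat k
      c∙hat≡ k = begin
        ⟦ c ⟧ ∙ column hat k                          ≡⟨ ≈0⇒multiple (code⇒divisible c c∈Code k) ⟩
        + N Δ * quotient (code⇒divisible c c∈Code k) ≡⟨ cong (+ N Δ *_) (q≡a∙p̂ k) ⟩
        + N Δ * a ∙ column (λ j → 1ℤ ∷ p j) k         ≡⟨ ∙-*ʳ (+ N Δ) a (column (λ j → 1ℤ ∷ p j) k) ⟨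
        a ∙ (λ j → + N Δ * (1ℤ ∷ p j) k)              ≡⟨ ∙-congʳ a (λ j → n∙hat j k) ⟨
        a ∙ (λ j → Y j ∙ column hat k)                ≡⟨ ∙-assoc a Y (column hat k) ⟨
        (λ i → a ∙ column Y i) ∙ column hat k         ∎
        where open ≡-Reasoning
      c≡ay : ∀ i → ⟦ c ⟧ i ≡ a ∙ column Y i
      c≡ay i = ℤ.i-j≡0⇒i≡j (⟦ c ⟧ i) (a ∙ column Y i) (hat-independent
        (λ i → ⟦ c ⟧ i - a ∙ column Y i)
        (λ k → trans (∙-minusˡ ⟦ c ⟧ (λ i → a ∙ column Y i) (column hat k))
          (ℤ.i≡j⇒i-j≡0 (c∙hat≡ k))) i)

  integral-solution : ∀ b → ∃ λ y → ∀ k → y ∙ column hat k ≡ + N Δ * b k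
  integral-solution b with D , D≢0 , z , z∙hat ← solvable-up-to-multiple hat hat-independent b =
    let y , _ , y∙hat = integral-multiple x b solution in y , y∙hat
    where
    instance _ = D≢0
    x : Vector ℚ (suc d)
    x i = z i / D
    solution : ∀ k → sumℚ (λ i → x i ℚ.* ι (hat i k)) ≡ ι (b k)
    solution k = *-cancelˡ-ι D (trans
      (clear-denominators (+ D) x z (λ i → m*[a/m]≡a D (z i)) (column hat k))
      (trans (cong ι (z∙hat k)) (sym (ι-* (+ D) (b k)))))

  divide-combination : ∀ {k} (p : Vector (Vector ℤ d) k) Y a t (y b : Vector ℤ (suc d)) →
    (∀ j l → Y j ∙ column hat l ≡ + N Δ * (1ℤ ∷ p j) l) →
    (∀ i → y i ≡ a ∙ column Y i + t i * + N Δ) →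
    (∀ l → y ∙ column hat l ≡ + N Δ * b l) →
    ∀ l → (a ++ t) ∙ column (λ j → 1ℤ ∷ (p ++ vertex Δ) j) l ≡ b l
  divide-combination {k} p Y a t y b Y∙hat y≡ y∙hat l =
    trans append (ℤ.*-cancelˡ-≡ (+ N Δ) (a ∙ p̂ + t ∙ column hat l) (b l) scaled)
    where
    p̂ : Vector ℤ k
    p̂ = column (λ j → 1ℤ ∷ p j) l
    append : (a ++ t) ∙ column (λ j → 1ℤ ∷ (p ++ vertex Δ) j) l ≡ a ∙ p̂ + t ∙ column hat l
    append = trans (sum-++ k (λ j → (a ++ t) j * (1ℤ ∷ (p ++ vertex Δ) j) l)) (cong₂ _+_
      (∑ℤ.sum-cong-≗ (λ j → cong₂ _*_ (lookup-++ˡ a t j)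
        (cong (λ p → (1ℤ ∷ p) l) (lookup-++ˡ p (vertex Δ) j))))
      (∑ℤ.sum-cong-≗ (λ i → cong₂ _*_ (lookup-++ʳ a t i)
        (cong (λ p → (1ℤ ∷ p) l) (lookup-++ʳ p (vertex Δ) i)))))
    scaled : + N Δ * (a ∙ p̂ + t ∙ column hat l) ≡ + N Δ * b l
    scaled = begin
      + N Δ * (a ∙ p̂ + t ∙ column hat l)
        ≡⟨ ℤ.*-distribˡ-+ (+ N Δ) (a ∙ p̂) (t ∙ column hat l) ⟩
      + N Δ * a ∙ p̂ + + N Δ * t ∙ column hat l
        ≡⟨ cong₂ _+_ (∙-*ʳ (+ N Δ) a p̂) (∙-*ˡ (+ N Δ) t (column hat l)) ⟨
      a ∙ (λ j → + N Δ * p̂ j) + (λ i → + N Δ * t i) ∙ column hat l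
        ≡⟨ cong₂ _+_ (∙-congʳ a (λ j → Y∙hat j l))
                     (∙-congˡ (λ i → ℤ.*-comm (t i) (+ N Δ)) (column hat l)) ⟨
      a ∙ (λ j → Y j ∙ column hat l) + (λ i → t i * + N Δ) ∙ column hat l
        ≡⟨ cong (_+ (λ i → t i * + N Δ) ∙ column hat l) (∙-assoc a Y (column hat l)) ⟨
      (λ i → a ∙ column Y i) ∙ column hat l + (λ i → t i * + N Δ) ∙ column hat l
        ≡⟨ ∙-+ˡ (λ i → a ∙ column Y i) (λ i → t i * + N Δ) (column hat l) ⟨
      (λ i → a ∙ column Y i + t i * + N Δ) ∙ column hat l
        ≡⟨ ∙-congˡ y≡ (column hat l) ⟨
      y ∙ column hat l
        ≡⟨ y∙hat l ⟩
      + N Δ * b l ∎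
      where open ≡-Reasoning

  IntegralCombination : Vector ℤ d → ℤ → Set
  IntegralCombination q h =
    ∃ λ n → ∃ λ (p : Vector (Vector ℤ d) n) → ∃ λ (a : Vector ℤ n) →
      (∀ j → LatticePoint Δ (p j)) ×
      (∀ k → sumℤ (λ j → a j * p j k) ≡ q k) ×
      sumℤ (λ j → a j * 1ℤ) ≡ h

  with-vertices : ∀ {k} (p : Vector (Vector ℤ d) k) (a : Vector ℤ k) (t : Vector ℤ (suc d)) q h →
    (∀ j → LatticePoint Δ (p j)) →
    (∀ l → (a ++ t) ∙ column (λ j → 1ℤ ∷ (p ++ vertex Δ) j) l ≡ (h ∷ q) l) →
    IntegralCombination q h
  with-vertices {k} p a t q h P combination =
    k ℕ.+ suc d , p ++ vertex Δ , a ++ t , points , (λ k → combination (suc k)) , combination zero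
    where
    points : ∀ j → LatticePoint Δ ((p ++ vertex Δ) j)
    points j with splitAt k j
    ... | inj₁ j = P j
    ... | inj₂ i = vertex-latticePoint i

  divisible-expansion : ∀ {k} (g : Vector (Word (N Δ) (suc d)) k) → Code Δ GeneratedBy g →
    ∀ y → Divisible y →
    ∃ λ a → ∃ λ (t : Vector ℤ (suc d)) → ∀ i → y i ≡ a ∙ column (⟦_⟧ ∘ g) i + t i * + N Δ
  divisible-expansion g generated y y∈ = expand (Equivalence.to (generated c) c∈Code)
    where
    c : Word (N Δ) (suc d)
    c = residue ∘ y
    c∈Code : Code Δ c
    c∈Code = divisible⇒code c (Divisible-resp-≈ ⟦ c ⟧ y (λ i → ≈-sym (residue-≈ (y i))) y∈)
    expand : (∃ λ a → ∀ i → c i ≡ linearCombination a g i) →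
      ∃ λ a → ∃ λ (t : Vector ℤ (suc d)) → ∀ i → y i ≡ a ∙ column (⟦_⟧ ∘ g) i + t i * + N Δ
    expand (a , c≡ag) = ⟦ a ⟧ , (λ i → quotient (y≈ag i)) , (λ i → equality (y≈ag i))
      where
      y≈ag : ∀ i → y i ≈ ⟦ a ⟧ ∙ column (⟦_⟧ ∘ g) i
      y≈ag i = ≈-trans (residue-≈ (y i)) (linearCombination⇒span {g = g} {c} a c≡ag i)

  generators-heightOne : ∀ {k} (g : Vector (Word (N Δ) (suc d)) k) → Code Δ GeneratedBy g →
    (∀ j → height (g j) ≡ 1ℚ) → ∀ j → HeightOneCodeword (g j)
  generators-heightOne g generated height≡1 j =
    code⇒divisible (g j) (Equivalence.from (generated (g j))
      (span⇒linearCombination {g = g} {w = g j} (span-row g j))) ,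
    height≡1⇒ (g j) (height≡1 j)

  generated⇒spanning : ∀ {k} (g : Vector (Word (N Δ) (suc d)) k) →
    Code Δ GeneratedBy g → (∀ j → height (g j) ≡ 1ℚ) → Spanning Δ
  generated⇒spanning {k} g generated height≡1 q h =
    spans (λ j → heightOne-latticePoint (g j) (generators-heightOne g generated height≡1 j))
          (integral-solution (h ∷ q))
    where
    spans : (∀ j → ∃ λ p → LatticePoint Δ p × (∀ l → ⟦ g j ⟧ ∙ column hat l ≡ + N Δ * (1ℤ ∷ p) l)) →
            (∃ λ y → ∀ l → y ∙ column hat l ≡ + N Δ * (h ∷ q) l) → IntegralCombination q h
    spans points (y , y∙hat) = combine
      (divisible-expansion g generated y (λ l → multiple⇒≈0 ((h ∷ q) l) (y∙hat l)))
      where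
      combine : (∃ λ a → ∃ λ (t : Vector ℤ (suc d)) →
                  ∀ i → y i ≡ a ∙ column (⟦_⟧ ∘ g) i + t i * + N Δ) → IntegralCombination q h
      combine (a , t , y≡) = with-vertices (proj₁ ∘ points) a t q h (proj₁ ∘ proj₂ ∘ points)
        (divide-combination (proj₁ ∘ points) (⟦_⟧ ∘ g) a t y (h ∷ q) (proj₂ ∘ proj₂ ∘ points) y≡ y∙hat)

proposition2p15 : ∀ {d : ℕ} (Δ : LatticeSimplex d) →
    Spanning Δ ⇔
    (∃ λ (k : ℕ) → ∃ λ (g : Vector (Word (N Δ) (suc d)) k) →
    (Code Δ GeneratedBy g) × (∀ j → height (g j) ≡ 1ℚ))
proposition2p15 Δ = mk⇔ (spanning⇒generated Δ)
  (λ (_ , g , generated , height≡1) → generated⇒spanning Δ g generated height≡1)
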